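{- Let $q$ be an odd prime power. If $-1$ is not a square in $\mathbb{F}_q$, then $\overline{\mathcal{I}}(\mathbb{F}_q,2)=\frac{q+1}{2}$. If $-1$ is a square in $\mathbb{F}_q$, then $\frac{q-1}{2}\le\overline{\mathcal{I}}(\mathbb{F}_q,2)\le\frac{q+3}{2}$.
   Context: For $u,v\in\mathbb{F}_q^2$ let $d^2(u,v)=(u_1-v_1)^2+(u_2-v_2)^2\in\mathbb{F}_q$. Two points are at integral distance if $d^2(u,v)=t^2$ for some $t\in\mathbb{F}_q$ (so $0$ is allowed). An integral point set is a set of points pairwise at integral distance. Points of $\mathbb{F}_q^2$ are collinear if they lie on a common affine line. $\overline{\mathcal{I}}(\mathbb{F}_q,2)$ denotes the maximum cardinality of an integral point set in $\mathbb{F}_q^2$ containing no three (distinct) collinear points. -}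

module Defs where

open import Algebra.Apartness.Bundles using (HeytingField)
open import Data.Fin.Base using (Fin)
open import Data.Nat.Base using (ℕ; suc; _^_; _≤_)
open import Data.Nat.Divisibility using (_∣_)
open import Data.Nat.Primality using (Prime)
open import Data.Product.Base using (_×_; _,_; ∃-syntax; ∃₂; proj₁; proj₂)
open import Data.Product.Relation.Binary.Pointwise.NonDependent using (_×ₛ_)
open import Function.Bundles using (Injection; Inverse)
open import Level using (Level; _⊔_)
open import Relation.Binary.Bundles using (Setoid)
open import Relation.Binary.PropositionalEquality using (_≡_)
import Relation.Binary.PropositionalEquality as ≡
open import Relation.Nullary.Negation using (¬_)

OddPrimePower : ℕ → Set
OddPrimePower q = ¬ (2 ∣ q) × (∃₂ λ p k → Prime p × q ≡ p ^ suc k)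

HasCardinality : ∀ {a ℓ} → Setoid a ℓ → ℕ → Set (a ⊔ ℓ)
HasCardinality S n = Inverse S (≡.setoid (Fin n))

-- On a carrier of finite cardinality `_≈_` is decidable, and the Heyting field
-- axioms then say exactly that 0# ≉ 1# and that every x ≉ 0# is invertible.
module Plane {c ℓ₁ ℓ₂ : Level} (F : HeytingField c ℓ₁ ℓ₂) where

  open HeytingField F

  pointSetoid : Setoid c ℓ₁
  pointSetoid = setoid ×ₛ setoid

  open Setoid pointSetoid public using () renaming (Carrier to Point; _≈_ to _≈ₚ_)

  -1# : Carrier
  -1# = - 1#

  IsSquare : Carrier → Set (c ⊔ ℓ₁)
  IsSquare x = ∃[ t ] x ≈ t * t

  d² : Point → Point → Carrier
  d² (u₁ , u₂) (v₁ , v₂) = (u₁ - v₁) * (u₁ - v₁) + (u₂ - v₂) * (u₂ - v₂)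

  AtIntegralDistance : Point → Point → Set (c ⊔ ℓ₁)
  AtIntegralDistance u v = IsSquare (d² u v)

  record Line : Set (c ⊔ ℓ₁) where
    field
      base      : Point
      direction : Point
      nonzero   : ¬ (direction ≈ₚ (0# , 0#))

  _∈ₗ_ : Point → Line → Set (c ⊔ ℓ₁)
  (x , y) ∈ₗ L = ∃[ t ] (x , y) ≈ₚ (proj₁ base + t * proj₁ direction , proj₂ base + t * proj₂ direction)
    where open Line L

  Collinear : Point → Point → Point → Set (c ⊔ ℓ₁)
  Collinear u v w = ∃[ L ] (u ∈ₗ L × v ∈ₗ L × w ∈ₗ L)

  -- A set of m points is given by an enumeration without repetition.
  PointSet : ℕ → Set (c ⊔ ℓ₁)
  PointSet m = Injection (≡.setoid (Fin m)) pointSetoid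

  module _ {m : ℕ} (P : PointSet m) where

    open Injection P using (to)

    IsIntegral : Set (c ⊔ ℓ₁)
    IsIntegral = ∀ i j → AtIntegralDistance (to i) (to j)

    NoThreeCollinear : Set (c ⊔ ℓ₁)
    NoThreeCollinear = ∀ i j k →
      ¬ (to i ≈ₚ to j) → ¬ (to i ≈ₚ to k) → ¬ (to j ≈ₚ to k) →
      ¬ Collinear (to i) (to j) (to k)

  Attained : ℕ → Set (c ⊔ ℓ₁)
  Attained m = ∃[ P ] (IsIntegral {m} P × NoThreeCollinear P)

  -- m is the maximum cardinality Ī(F, 2).
  IsĪ : ℕ → Set (c ⊔ ℓ₁)
  IsĪ m = Attained m × (∀ n → Attained n → n ≤ m)

{-# OPTIONS --safe #-}

-- Identify F² with F[i], i² = -1 (not a field when -1 is a square), and the directions of the plane with the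
-- projective line P¹, on which multiplication by 1 + i acts as a map ρ with ρ⁴ = id. The integral directions are
-- those of the squares v², and v², w² have the same direction iff w = v or w = i v in P¹, i.e. iff v and w are in
-- the same orbit of τ = ρ². Let f be the number of fixed points of τ, which are the isotropic directions (none if
-- -1 is not a square, at most 2 otherwise), and let A contain one point of each 2-element orbit. Then
-- q + 1 = f + 2 #A, and #A is even because ρ induces an involution without fixed points on these orbits.
--
-- Upper bound: colouring {u , v} by the direction of u - v properly colours the edges of the complete graph on the
-- given point set with at most f + #A colours. As this number is even, there are at most f + #A vertices.
--
-- Lower bound: for v in A the points (v / v̄)² are distinct, lie on the unit circle and are pairwise at integral distance.
module Submission where

open import Defs
open import Algebra.Apartness.Bundles using (HeytingField; HeytingCommutativeRing)
open import Algebra.Bundles using (CommutativeRing)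
import Algebra.Solver.Ring
open import Algebra.Solver.Ring.AlmostCommutativeRing
  using (AlmostCommutativeRing; fromCommutativeRing; _-Raw-AlmostCommutative⟶_)
open import Data.Fin.Base as Fin using (Fin; zero; suc)
import Data.Fin.Properties as Fin
import Data.Integer.Base as ℤ
import Data.Integer.Properties as ℤ
open import Data.List.Base using (List; []; _∷_; length; filter; lookup; allFin)
open import Data.List.Membership.Propositional.Properties using (∈-lookup; ∈-filter⁺; ∈-filter⁻; ∈-allFin)
open import Data.List.Properties using (filter-all; length-tabulate)
open import Data.List.Relation.Unary.All as All using ()
open import Data.List.Relation.Unary.AllPairs using (_∷_)
open import Data.List.Relation.Unary.Any using (index)
open import Data.List.Relation.Unary.Any.Properties using (lookup-index)
open import Data.List.Relation.Unary.Unique.Propositional using (Unique)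
import Data.List.Relation.Unary.Unique.Propositional.Properties as Unique
open import Data.Maybe.Base using (Maybe; just; nothing)
open import Data.Nat.Base as ℕ using (ℕ; zero; suc; _≤_; z≤n; s≤s)
open import Data.Nat.DivMod using (_/_; m*n/n≡m; /-monoˡ-≤)
open import Data.Nat.Divisibility using (_∣_; divides; n∣m*n; ∣1⇒≡1; ∣m∣n⇒∣m+n; ∣m+n∣m⇒∣n)
import Data.Nat.Properties as ℕ
open import Data.Nat.Solver using (module +-*-Solver)
open import Data.Product.Base using (_×_; _,_; ∃-syntax; proj₁; proj₂)
open import Data.Sum.Base using (_⊎_; inj₁; inj₂; [_,_]′)
open import Function.Base using (_∘_; id)
open import Function.Bundles using (Inverse; Injection)
open import Level using (Level; _⊔_)
open import Relation.Binary.Definitions using (tri<; tri≈; tri>)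
import Relation.Binary.PropositionalEquality as ≡
open import Relation.Binary.PropositionalEquality using (_≡_; _≢_)
open import Relation.Nullary.Decidable using (Dec; yes; no; ¬?; _×-dec_; _→-dec_; map′)
open import Relation.Nullary.Negation using (¬_; contradiction)
open import Relation.Unary using (Pred; Decidable)

-- Ring solver with integer coefficients.

-- Coefficients in ℤ rather than in R itself, since the ring solver must recognise 1 - 1 as zero by computation.
module IntegerCoefficients {c ℓ} (R : CommutativeRing c ℓ) where

  open CommutativeRing R
  open import Data.Integer.Base using (ℤ; +_; -[1+_]; _⊖_)
  open import Algebra.Properties.Ring ring using (-‿distribˡ-*; -‿distribʳ-*; -0#≈0#; -‿involutive)
  open import Algebra.Properties.AbelianGroup +-abelianGroup using (⁻¹-∙-comm)
  open import Algebra.Properties.Semiring.Mult.TCOptimised semiring using (1+×; ×-homo-+; ×1-homo-*) renaming (_×_ to _×ₙ_)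
  open import Relation.Binary.Reasoning.Setoid setoid

  ⟦_⟧ℤ : ℤ → Carrier
  ⟦ + n ⟧ℤ      = n ×ₙ 1#
  ⟦ -[1+ n ] ⟧ℤ = - (suc n ×ₙ 1#)

  ⟦⟧-cong : ∀ {i j} → i ≡ j → ⟦ i ⟧ℤ ≈ ⟦ j ⟧ℤ
  ⟦⟧-cong ≡.refl = refl

  ⟦⟧-⊖ : ∀ m n → ⟦ m ⊖ n ⟧ℤ ≈ m ×ₙ 1# - n ×ₙ 1#
  ⟦⟧-⊖ zero    zero    = sym (-‿inverseʳ 0#)
  ⟦⟧-⊖ zero    (suc n) = sym (+-identityˡ _)
  ⟦⟧-⊖ (suc m) zero    = sym (trans (+-congˡ -0#≈0#) (+-identityʳ _))
  ⟦⟧-⊖ (suc m) (suc n) = begin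
    ⟦ suc m ⊖ suc n ⟧ℤ                   ≈⟨ ⟦⟧-cong (ℤ.[1+m]⊖[1+n]≡m⊖n m n) ⟩
    ⟦ m ⊖ n ⟧ℤ                           ≈⟨ ⟦⟧-⊖ m n ⟩
    -- The inserted zero becomes `1# - 1#`, one unit for each side of the difference.
    m ×ₙ 1# - n ×ₙ 1#                      ≈⟨ +-congʳ (+-identityʳ _) ⟨
    m ×ₙ 1# + 0# - n ×ₙ 1#                 ≈⟨ +-congʳ (+-congˡ (-‿inverseʳ 1#)) ⟨
    m ×ₙ 1# + (1# - 1#) - n ×ₙ 1#          ≈⟨ +-congʳ (+-assoc _ _ _) ⟨
    m ×ₙ 1# + 1# - 1# - n ×ₙ 1#            ≈⟨ +-assoc _ _ _ ⟩
    m ×ₙ 1# + 1# + (- 1# - n ×ₙ 1#)        ≈⟨ +-cong (+-comm _ _) (⁻¹-∙-comm _ _) ⟩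
    1# + m ×ₙ 1# - (1# + n ×ₙ 1#)          ≈⟨ +-cong (1+× m 1#) (-‿cong (1+× n 1#)) ⟨
    suc m ×ₙ 1# - suc n ×ₙ 1#              ∎

  ⟦⟧-- : ∀ i → ⟦ ℤ.- i ⟧ℤ ≈ - ⟦ i ⟧ℤ
  ⟦⟧-- (+ zero)  = sym -0#≈0#
  ⟦⟧-- (+ suc n) = refl
  ⟦⟧-- -[1+ n ]  = sym (-‿involutive _)

  ⟦⟧-+ : ∀ i j → ⟦ i ℤ.+ j ⟧ℤ ≈ ⟦ i ⟧ℤ + ⟦ j ⟧ℤ
  ⟦⟧-+ (+ m)    (+ n)    = ×-homo-+ 1# m n
  ⟦⟧-+ (+ m)    -[1+ n ] = ⟦⟧-⊖ m (suc n)
  ⟦⟧-+ -[1+ m ] (+ n)    = trans (⟦⟧-⊖ n (suc m)) (+-comm _ _)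
  ⟦⟧-+ -[1+ m ] -[1+ n ] = begin
    - (suc (suc (m ℕ.+ n)) ×ₙ 1#)         ≈⟨ ⟦⟧-cong (≡.cong -[1+_] (≡.sym (ℕ.+-suc m n))) ⟩
    - ((suc m ℕ.+ suc n) ×ₙ 1#)           ≈⟨ -‿cong (×-homo-+ 1# (suc m) (suc n)) ⟩
    - (suc m ×ₙ 1# + suc n ×ₙ 1#)          ≈⟨ ⁻¹-∙-comm _ _ ⟨
    - (suc m ×ₙ 1#) - suc n ×ₙ 1#          ∎

  ⟦⟧-*⁺ : ∀ m j → ⟦ + m ℤ.* j ⟧ℤ ≈ m ×ₙ 1# * ⟦ j ⟧ℤ
  ⟦⟧-*⁺ m (+ n)    = trans (⟦⟧-cong (≡.sym (ℤ.pos-* m n))) (×1-homo-* m n)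
  ⟦⟧-*⁺ m -[1+ n ] = begin
    ⟦ + m ℤ.* -[1+ n ] ⟧ℤ                ≈⟨ ⟦⟧-cong (≡.sym (ℤ.neg-distribʳ-* (+ m) (+ suc n))) ⟩
    ⟦ ℤ.- (+ m ℤ.* + suc n) ⟧ℤ           ≈⟨ ⟦⟧-- (+ m ℤ.* + suc n) ⟩
    - ⟦ + m ℤ.* + suc n ⟧ℤ               ≈⟨ -‿cong (⟦⟧-*⁺ m (+ suc n)) ⟩
    - (m ×ₙ 1# * (suc n ×ₙ 1#))            ≈⟨ -‿distribʳ-* _ _ ⟩
    m ×ₙ 1# * - (suc n ×ₙ 1#)              ∎

  ⟦⟧-* : ∀ i j → ⟦ i ℤ.* j ⟧ℤ ≈ ⟦ i ⟧ℤ * ⟦ j ⟧ℤ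
  ⟦⟧-* (+ m)    j = ⟦⟧-*⁺ m j
  ⟦⟧-* -[1+ m ] j = begin
    ⟦ -[1+ m ] ℤ.* j ⟧ℤ                  ≈⟨ ⟦⟧-cong (≡.sym (ℤ.neg-distribˡ-* (+ suc m) j)) ⟩
    ⟦ ℤ.- (+ suc m ℤ.* j) ⟧ℤ             ≈⟨ ⟦⟧-- (+ suc m ℤ.* j) ⟩
    - ⟦ + suc m ℤ.* j ⟧ℤ                 ≈⟨ -‿cong (⟦⟧-*⁺ (suc m) j) ⟩
    - (suc m ×ₙ 1# * ⟦ j ⟧ℤ)              ≈⟨ -‿distribˡ-* _ _ ⟩
    - (suc m ×ₙ 1#) * ⟦ j ⟧ℤ              ∎

  almostCommutativeRing : AlmostCommutativeRing c ℓ
  almostCommutativeRing = fromCommutativeRing R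

  morphism : ℤ.+-*-rawRing -Raw-AlmostCommutative⟶ almostCommutativeRing
  morphism = record
    { ⟦_⟧    = ⟦_⟧ℤ
    ; +-homo = ⟦⟧-+
    ; *-homo = ⟦⟧-*
    ; -‿homo = ⟦⟧--
    ; 0-homo = refl
    ; 1-homo = refl
    }

  ⟦⟧-≟ : ∀ i j → Maybe (⟦ i ⟧ℤ ≈ ⟦ j ⟧ℤ)
  ⟦⟧-≟ i j with i ℤ.≟ j
  ... | yes i≡j = just (⟦⟧-cong i≡j)
  ... | no  _   = nothing

  open Algebra.Solver.Ring ℤ.+-*-rawRing almostCommutativeRing morphism ⟦⟧-≟ public
    using (Polynomial; solve; _:=_; _:+_; _:*_; _:-_; :-_; con)

-- Counting in finite sets.

module Counting where

  open import Data.Nat.Base using (_+_; _*_)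
  open import Relation.Binary.PropositionalEquality using (refl; sym; trans; cong; subst)

  private variable
    p r s : Level
    m n : ℕ

  lookup-injective : ∀ {a} {A : Set a} {xs : List A} → Unique xs → ∀ {i j} → lookup xs i ≡ lookup xs j → i ≡ j
  lookup-injective (_   ∷ _)  {zero}  {zero}  _  = refl
  lookup-injective (x∉ ∷ _)   {zero}  {suc j} eq = contradiction eq (All.lookup x∉ (∈-lookup j))
  lookup-injective (x∉ ∷ _)   {suc i} {zero}  eq = contradiction (sym eq) (All.lookup x∉ (∈-lookup i))
  lookup-injective (_   ∷ xs) {suc i} {suc j} eq = cong suc (lookup-injective xs eq)

  count : {P : Pred (Fin n) p} → Decidable P → ℕ
  count P? = length (filter P? (allFin _))

  module _ {P : Pred (Fin n) p} (P? : Decidable P) where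

    nth : Fin (count P?) → Fin n
    nth = lookup (filter P? (allFin n))

    nth-satisfies : ∀ k → P (nth k)
    nth-satisfies k = proj₂ (∈-filter⁻ P? {xs = allFin n} (∈-lookup k))

    nth-injective : ∀ {k l} → nth k ≡ nth l → k ≡ l
    nth-injective = lookup-injective (Unique.filter⁺ P? (Unique.allFin⁺ n))

    rank : ∀ x → P x → Fin (count P?)
    rank x px = index (∈-filter⁺ P? (∈-allFin x) px)

    nth-rank : ∀ x px → nth (rank x px) ≡ x
    nth-rank x px = sym (lookup-index (∈-filter⁺ P? (∈-allFin x) px))

    rank-injective : ∀ {x y} px py → rank x px ≡ rank y py → x ≡ y
    rank-injective px py eq = trans (sym (nth-rank _ px)) (trans (cong nth eq) (nth-rank _ py))

    injection⇒count-≤ : (f : ∀ x → P x → Fin m) → (∀ {x y} px py → f x px ≡ f y py → x ≡ y) → count P? ≤ m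
    injection⇒count-≤ f f-injective =
      Fin.injective⇒≤ {f = λ k → f (nth k) (nth-satisfies k)} (λ eq → nth-injective (f-injective _ _ eq))

    empty⇒count≡0 : (∀ x → ¬ P x) → count P? ≡ 0
    empty⇒count≡0 empty = ℕ.n≤0⇒n≡0 (injection⇒count-≤ (λ x px → contradiction px (empty x))
      (λ {x} px _ _ → contradiction px (empty x)))

    count-universal : (∀ x → P x) → count P? ≡ n
    count-universal all = trans (cong length (filter-all P? (All.universal all (allFin n)))) (length-tabulate id)

  module _ {P : Pred (Fin m) p} {R : Pred (Fin n) r} (P? : Decidable P) (R? : Decidable R) where

    count-≤ : (f : ∀ x → P x → Fin n) → (∀ x px → R (f x px)) →
              (∀ {x y} px py → f x px ≡ f y py → x ≡ y) → count P? ≤ count R?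
    count-≤ f f-R f-injective = injection⇒count-≤ P? (λ x px → rank R? (f x px) (f-R x px))
      (λ px py eq → f-injective px py (rank-injective R? _ _ eq))

  module _ {P : Pred (Fin n) p} {R : Pred (Fin n) r} {S : Pred (Fin n) s}
           (P? : Decidable P) (R? : Decidable R) (S? : Decidable S) where

    count-disjoint : (∀ {x} → P x → R x ⊎ S x) → (∀ {x} → R x → P x) → (∀ {x} → S x → P x) →
                     (∀ {x} → R x → ¬ S x) → count P? ≡ count R? + count S?
    count-disjoint P⇒R⊎S R⇒P S⇒P R⇒¬S = go (allFin n)
      where
      go : ∀ xs → length (filter P? xs) ≡ length (filter R? xs) + length (filter S? xs)
      go [] = refl
      go (x ∷ xs) with P? x | R? x | S? x
      ... | _      | yes r | yes s = contradiction s (R⇒¬S r)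
      ... | yes px | no ¬r | no ¬s = contradiction (P⇒R⊎S px) [ ¬r , ¬s ]′
      ... | no ¬p  | yes r | _     = contradiction (R⇒P r) ¬p
      ... | no ¬p  | _     | yes s = contradiction (S⇒P s) ¬p
      ... | yes _  | yes _ | no  _ = cong suc (go xs)
      ... | yes _  | no  _ | yes _ = trans (cong suc (go xs)) (sym (ℕ.+-suc _ _))
      ... | no  _  | no  _ | no  _ = go xs

  -- Involutions without fixed points.

  module FreeInvolution {S : Pred (Fin n) s} (S? : Decidable S) (σ : Fin n → Fin n)
    (σ-S : ∀ {x} → S x → S (σ x)) (σσ≡id : ∀ {x} → S x → σ (σ x) ≡ x) (σ-free : ∀ {x} → S x → σ x ≢ x) where

    -- Selects one element of each two-element orbit in `S`, the smaller one.
    Lower? : Decidable (λ x → S x × x Fin.< σ x)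
    Lower? x = S? x ×-dec (x Fin.<? σ x)

    Upper? : Decidable (λ x → S x × σ x Fin.< x)
    Upper? x = S? x ×-dec (σ x Fin.<? x)

    private
      σ-injective : ∀ {x y} → S x → S y → σ x ≡ σ y → x ≡ y
      σ-injective sx sy eq = trans (sym (σσ≡id sx)) (trans (cong σ eq) (σσ≡id sy))

      #lower≡#upper : count Lower? ≡ count Upper?
      #lower≡#upper = ℕ.≤-antisym
        (count-≤ Lower? Upper? (λ x _ → σ x)
          (λ x (sx , x<σx) → σ-S sx , subst (Fin._< σ x) (sym (σσ≡id sx)) x<σx)
          (λ (sx , _) (sy , _) → σ-injective sx sy))
        (count-≤ Upper? Lower? (λ x _ → σ x)
          (λ x (sx , σx<x) → σ-S sx , subst (σ x Fin.<_) (sym (σσ≡id sx)) σx<x)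
          (λ (sx , _) (sy , _) → σ-injective sx sy))

      lower-or-upper : ∀ {x} → S x → (S x × x Fin.< σ x) ⊎ (S x × σ x Fin.< x)
      lower-or-upper {x} sx with Fin.<-cmp x (σ x)
      ... | tri< x<σx _ _ = inj₁ (sx , x<σx)
      ... | tri≈ _ x≡σx _ = contradiction (sym x≡σx) (σ-free sx)
      ... | tri> _ _ σx<x = inj₂ (sx , σx<x)

    count≡lower*2 : count S? ≡ count Lower? * 2
    count≡lower*2 = trans
      (count-disjoint S? Lower? Upper? lower-or-upper proj₁ proj₁ (λ (_ , x<σx) (_ , σx<x) → Fin.<-asym x<σx σx<x))
      (trans (cong (count Lower? +_) (trans (sym #lower≡#upper) (sym (ℕ.+-identityʳ _)))) (ℕ.*-comm 2 (count Lower?)))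

    2∣count : 2 ∣ count S?
    2∣count = divides (count Lower?) count≡lower*2

  2∣n⊎2∣1+n : ∀ n → 2 ∣ n ⊎ 2 ∣ suc n
  2∣n⊎2∣1+n zero    = inj₁ (divides 0 refl)
  2∣n⊎2∣1+n (suc n) with 2∣n⊎2∣1+n n
  ... | inj₁ 2∣n   = inj₂ (∣m∣n⇒∣m+n (divides 1 refl) 2∣n)
  ... | inj₂ 2∣1+n = inj₁ 2∣1+n

  2∤n⇒2∣1+n : ∀ {n} → ¬ 2 ∣ n → 2 ∣ suc n
  2∤n⇒2∣1+n {n} 2∤n with 2∣n⊎2∣1+n n
  ... | inj₁ 2∣n   = contradiction 2∣n 2∤n
  ... | inj₂ 2∣1+n = 2∣1+n

  free-involution⇒even : (σ : Fin n → Fin n) → (∀ x → σ (σ x) ≡ x) → (∀ x → σ x ≢ x) → 2 ∣ n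
  free-involution⇒even {n} σ σσ≡id σ-free = subst (2 ∣_) (count-universal S? (λ x → σ-free x)) 2∣count
    where
    -- This predicate holds everywhere, so it counts all of `Fin n`, and freeness on it is `id`.
    S? : Decidable (λ x → σ x ≢ x)
    S? x = ¬? (σ x Fin.≟ x)
    open FreeInvolution S? σ (λ {x} _ → σ-free (σ x)) (λ {x} _ → σσ≡id x) id

  -- Orbits of a map of order dividing four.

  module OrderFour (ρ : Fin n → Fin n) (ρ⁴≡id : ∀ x → ρ (ρ (ρ (ρ x))) ≡ x) where

    τ : Fin n → Fin n
    τ x = ρ (ρ x)

    Fixed? : Decidable (λ x → τ x ≡ x)
    Fixed? x = τ x Fin.≟ x

    Moved? : Decidable (λ x → τ x ≢ x)
    Moved? x = ¬? (Fixed? x)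

    private
      ρ-moved : ∀ {x} → τ x ≢ x → τ (ρ x) ≢ ρ x
      ρ-moved {x} moved eq = moved (trans (sym (ρ⁴≡id (τ x))) (trans (cong (ρ ∘ τ) eq) (ρ⁴≡id x)))

      τ-moved : ∀ {x} → τ x ≢ x → τ (τ x) ≢ τ x
      τ-moved = ρ-moved ∘ ρ-moved

    open FreeInvolution Moved? τ τ-moved (λ {x} _ → ρ⁴≡id x) id public
      using () renaming (Lower? to A?; count≡lower*2 to #moved≡#A*2)

    A : Pred (Fin n) _
    A x = τ x ≢ x × x Fin.< τ x

    n≡#fixed+#A*2 : n ≡ count Fixed? + count A? * 2
    n≡#fixed+#A*2 = trans (sym (count-universal All? λ x → em x))
      (trans (count-disjoint All? Fixed? Moved? id inj₁ inj₂ (λ eq neq → neq eq)) (cong (count Fixed? +_) #moved≡#A*2))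
      where
      em : ∀ x → τ x ≡ x ⊎ τ x ≢ x
      em x with Fixed? x
      ... | yes eq = inj₁ eq
      ... | no neq = inj₂ neq
      All? : Decidable (λ x → τ x ≡ x ⊎ τ x ≢ x)
      All? x = yes (em x)

    -- The smaller of `x` and `τ x`, a canonical representative of the orbit of `x` under `τ`.
    κ : Fin n → Fin n
    κ x with x Fin.<? τ x
    ... | yes _ = x
    ... | no  _ = τ x

    κ≡id⊎τ : ∀ x → κ x ≡ x ⊎ κ x ≡ τ x
    κ≡id⊎τ x with x Fin.<? τ x
    ... | yes _ = inj₁ refl
    ... | no  _ = inj₂ refl

    κ-moved : ∀ {x} → τ x ≢ x → A (κ x)
    κ-moved {x} moved with x Fin.<? τ x
    ... | yes x<τx = moved , x<τx
    ... | no  x≮τx with Fin.<-cmp x (τ x)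
    ...   | tri< x<τx _ _ = contradiction x<τx x≮τx
    ...   | tri≈ _ x≡τx _ = contradiction (sym x≡τx) moved
    ...   | tri> _ _ τx<x = τ-moved moved , subst (τ x Fin.<_) (sym (ρ⁴≡id x)) τx<x

    κ-fixed : ∀ {x} → τ x ≡ x → τ (κ x) ≡ κ x
    κ-fixed {x} fixed with κ≡id⊎τ x
    ... | inj₁ eq = subst (λ y → τ y ≡ y) (sym eq) fixed
    ... | inj₂ eq = subst (λ y → τ y ≡ y) (sym eq) (cong τ fixed)

    private
      κ-A : ∀ {x} → A x → κ x ≡ x
      κ-A {x} (_ , x<τx) with x Fin.<? τ x
      ... | yes _    = refl
      ... | no  x≮τx = contradiction x<τx x≮τx

      κ-τ : ∀ {x} → A x → κ (τ x) ≡ x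
      κ-τ {x} (_ , x<τx) with τ x Fin.<? τ (τ x)
      ... | yes τx<ττx = contradiction (subst (τ x Fin.<_) (ρ⁴≡id x) τx<ττx) (Fin.<-asym x<τx)
      ... | no  _      = ρ⁴≡id x

      -- `κ ∘ ρ` is the map that `ρ` induces on representatives: `κ (ρ x)` is `ρ x` or `ρ³ x`, so
      -- one more `ρ` gives `τ x` or `x`, and `κ` sends both to `x`.
      κρκρ : ∀ {x} → A x → κ (ρ (κ (ρ x))) ≡ x
      κρκρ {x} ax with κ≡id⊎τ (ρ x)
      ... | inj₁ eq = trans (cong (κ ∘ ρ) eq) (κ-τ ax)
      ... | inj₂ eq = trans (cong (κ ∘ ρ) eq) (trans (cong κ (ρ⁴≡id x)) (κ-A ax))

      -- A fixed orbit would give `ρ x = x` or `ρ³ x = x`. The latter also yields `ρ x = x` by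
      -- `ρ⁴ = id`, and then `τ x = x`.
      κρ-free : ∀ {x} → A x → κ (ρ x) ≢ x
      κρ-free {x} (moved , _) κρx≡x with κ≡id⊎τ (ρ x)
      ... | inj₁ eq = moved (trans (cong ρ ρx≡x) ρx≡x)
        where
        ρx≡x : ρ x ≡ x
        ρx≡x = trans (sym eq) κρx≡x
      ... | inj₂ eq = moved (trans (cong ρ ρx≡x) ρx≡x)
        where
        ρx≡x : ρ x ≡ x
        ρx≡x = trans (sym (cong ρ (trans (sym eq) κρx≡x))) (ρ⁴≡id x)

    2∣#A : 2 ∣ count A?
    2∣#A = FreeInvolution.2∣count A? (κ ∘ ρ) (κ-moved ∘ ρ-moved ∘ proj₁) κρκρ κρ-free

    -- As `n` and twice the size of `A` are even, so is the number of fixed points; the size of `A`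
    -- is even by `2∣#A`.
    2∣#fixed+#A : 2 ∣ n → 2 ∣ count Fixed? + count A?
    2∣#fixed+#A 2∣n = ∣m∣n⇒∣m+n
      (∣m+n∣m⇒∣n (subst (2 ∣_) (trans n≡#fixed+#A*2 (ℕ.+-comm (count Fixed?) _)) 2∣n) (n∣m*n (count A?))) 2∣#A

    -- If `y = τ x`, membership in `A` would give both `x < y` and `y < x`.
    A-representative : ∀ {x y} → A x → A y → y ≡ x ⊎ y ≡ τ x → x ≡ y
    A-representative _ _ (inj₁ y≡x) = sym y≡x
    A-representative {x} {y} (_ , x<τx) (_ , y<τy) (inj₂ y≡τx) =
      contradiction (subst (y Fin.<_) (trans (cong τ y≡τx) (ρ⁴≡id x)) y<τy)
                    (Fin.<-asym (subst (x Fin.<_) (sym y≡τx) x<τx))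

    module Image {f : Fin n → Fin m} (f∘τ≡f : ∀ x → f (τ x) ≡ f x) where

      Image? : Decidable (λ y → ∃[ x ] f x ≡ y)
      Image? y = Fin.any? (λ x → f x Fin.≟ y)

      private
        Rep? : Decidable (λ x → τ x ≡ x ⊎ A x)
        Rep? x with Fixed? x | A? x
        ... | yes fixed | _     = yes (inj₁ fixed)
        ... | no  _     | yes a = yes (inj₂ a)
        ... | no ¬fixed | no ¬a = no [ ¬fixed , ¬a ]′

        κ-rep : ∀ x → τ (κ x) ≡ κ x ⊎ A (κ x)
        κ-rep x with Fixed? x
        ... | yes fixed = inj₁ (κ-fixed fixed)
        ... | no  moved = inj₂ (κ-moved moved)

        f∘κ≡f : ∀ x → f (κ x) ≡ f x
        f∘κ≡f x with κ≡id⊎τ x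
        ... | inj₁ eq = cong f eq
        ... | inj₂ eq = trans (cong f eq) (f∘τ≡f x)

      -- Replace a preimage `x` of `y` by `κ x`, which is a fixed point or lies in `A`. Since
      -- `f ∘ κ = f`, it still determines `y`.
      #image≤ : count Image? ≤ count Fixed? + count A?
      #image≤ = ℕ.≤-trans
        (count-≤ Image? Rep? (λ _ (x , _) → κ x) (λ _ (x , _) → κ-rep x)
          (λ (x , fx≡y) (x′ , fx′≡y′) eq →
            trans (sym (trans (f∘κ≡f x) fx≡y)) (trans (cong f eq) (trans (f∘κ≡f x′) fx′≡y′))))
        (ℕ.≤-reflexive (count-disjoint Rep? Fixed? A? id inj₁ inj₂ (λ fixed (moved , _) → moved fixed)))

  -- Proper edge colourings of complete graphs.

  module ProperColouring {C : Pred (Fin n) s} (C? : Decidable C) {c₀ : Fin n} (c₀∈C : C c₀)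
    (colour : Fin m → Fin m → Fin n)
    (colour-sym : ∀ i j → colour i j ≡ colour j i)
    (colour-C : ∀ {i j} → i ≢ j → C (colour i j))
    (colour-proper : ∀ {i j k} → i ≢ j → i ≢ k → colour i j ≡ colour i k → j ≡ k) where

    -- The edges at `i` have distinct colours in `C`; the extra value `zero` is for `i` itself.
    m≤1+#C : Fin m → m ≤ suc (count C?)
    m≤1+#C i = Fin.injective⇒≤ {f = f} f-injective
      where
      f : Fin m → Fin (suc (count C?))
      f j with i Fin.≟ j
      ... | yes _  = zero
      ... | no i≢j = suc (rank C? _ (colour-C i≢j))
      f-injective : ∀ {j k} → f j ≡ f k → j ≡ k
      f-injective {j} {k} eq with i Fin.≟ j | i Fin.≟ k
      ... | yes i≡j | yes i≡k = trans (sym i≡j) i≡k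
      ... | no i≢j  | no i≢k  = colour-proper i≢j i≢k (rank-injective C? _ _ (Fin.suc-injective eq))

    Mate : Fin m → Pred (Fin m) _
    Mate i j = i ≢ j × colour i j ≡ c₀

    -- With no edge of colour `c₀` at `i`, that colour is free to encode `i` itself, which saves the
    -- extra value.
    unmatched⇒m≤#C : ∀ i → ¬ (∃[ j ] Mate i j) → m ≤ count C?
    unmatched⇒m≤#C i unmatched = Fin.injective⇒≤ {f = f} f-injective
      where
      f : Fin m → Fin (count C?)
      f j with i Fin.≟ j
      ... | yes _  = rank C? c₀ c₀∈C
      ... | no i≢j = rank C? _ (colour-C i≢j)
      f-injective : ∀ {j k} → f j ≡ f k → j ≡ k
      f-injective {j} {k} eq with i Fin.≟ j | i Fin.≟ k
      ... | yes i≡j | yes i≡k = trans (sym i≡j) i≡k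
      ... | no i≢j  | no i≢k  = colour-proper i≢j i≢k (rank-injective C? _ _ eq)
      ... | yes _   | no i≢k  = contradiction (_ , i≢k , sym (rank-injective C? _ _ eq)) unmatched
      ... | no i≢j  | yes _   = contradiction (_ , i≢j , rank-injective C? _ _ eq) unmatched

    -- Every vertex has an edge of colour `c₀`, as otherwise `unmatched⇒m≤#C` applies. Properness
    -- makes these edges a perfect matching, and swapping partners is an involution without fixed
    -- points.
    m≡1+#C⇒2∣m : m ≡ suc (count C?) → 2 ∣ m
    m≡1+#C⇒2∣m m≡1+#C = free-involution⇒even (proj₁ ∘ mate) mate-mate (λ i eq → proj₁ (proj₂ (mate i)) (sym eq))
      where
      mate : ∀ i → ∃[ j ] Mate i j
      mate i with Fin.any? (λ j → ¬? (i Fin.≟ j) ×-dec (colour i j Fin.≟ c₀))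
      ... | yes found    = found
      ... | no unmatched = contradiction (subst (_≤ count C?) m≡1+#C (unmatched⇒m≤#C i unmatched)) ℕ.1+n≰n
      mate-mate : ∀ i → proj₁ (mate (proj₁ (mate i))) ≡ i
      mate-mate i with j , i≢j , ij≡c₀ ← mate i with k , j≢k , jk≡c₀ ← mate j =
        colour-proper j≢k (i≢j ∘ sym) (trans jk≡c₀ (trans (sym ij≡c₀) (colour-sym i j)))

    -- If m were 1 + b, every colour class would be a perfect matching, although 1 + b is odd.
    m≤even-bound : ∀ {b} → count C? ≤ b → 2 ∣ b → m ≤ b
    m≤even-bound {b} #C≤b 2∣b with m ℕ.≟ 0 | m ℕ.≟ suc b
    ... | yes refl | _        = z≤n
    ... | no m≢0   | no m≢1+b =
      ℕ.s≤s⁻¹ (ℕ.≤∧≢⇒< (ℕ.≤-trans (m≤1+#C (Fin.fromℕ< (ℕ.n≢0⇒n>0 m≢0))) (s≤s #C≤b)) m≢1+b)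
    ... | no m≢0   | yes refl = contradiction (∣1⇒≡1 (∣m+n∣m⇒∣n (subst (2 ∣_) (ℕ.+-comm 1 b) 2∣1+b) 2∣b)) λ ()
      where
      2∣1+b : 2 ∣ suc b
      2∣1+b = m≡1+#C⇒2∣m (ℕ.≤-antisym (m≤1+#C zero) (s≤s #C≤b))

  -- Maxima of bounded decidable predicates.

  module _ {P : Pred ℕ p} (P? : Decidable P) where

    -- Search downwards from `b`. The witness `a` never exceeds the current bound, so at `zero` it
    -- is itself `0` and the search cannot fail.
    bounded⇒maximum : ∀ {a} b → P a → (∀ n → P n → n ≤ b) → ∃[ m ] (P m × (∀ n → P n → n ≤ m))
    bounded⇒maximum b pa bound with P? b
    ... | yes pb = b , pb , bound
    bounded⇒maximum zero pa bound | no ¬pb = contradiction (subst P (ℕ.n≤0⇒n≡0 (bound _ pa)) pa) ¬pb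
    bounded⇒maximum (suc b) pa bound | no ¬pb = bounded⇒maximum b pa
      (λ n pn → ℕ.s≤s⁻¹ (ℕ.≤∧≢⇒< (bound n pn) (λ n≡1+b → ¬pb (subst P n≡1+b pn))))

open Counting

-- Arithmetic of the bounds, for `f` fixed points and `a` two-element orbits.

module _ {q f a : ℕ} (1+q≡f+a*2 : suc q ≡ f ℕ.+ a ℕ.* 2) where

  open ℕ.≤-Reasoning

  f≡0⇒a≡[q+1]/2 : f ≡ 0 → a ≡ (q ℕ.+ 1) / 2
  f≡0⇒a≡[q+1]/2 f≡0 = begin-equality
    a              ≡⟨ m*n/n≡m a 2 ⟨
    a ℕ.* 2 / 2    ≡⟨ ≡.cong (_/ 2) (≡.trans 1+q≡f+a*2 (≡.cong (ℕ._+ a ℕ.* 2) f≡0)) ⟨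
    suc q / 2      ≡⟨ ≡.cong (_/ 2) (ℕ.+-comm 1 q) ⟩
    (q ℕ.+ 1) / 2  ∎

  f≤2⇒[q∸1]/2≤a : f ≤ 2 → (q ℕ.∸ 1) / 2 ≤ a
  f≤2⇒[q∸1]/2≤a f≤2 = begin
    -- By computation `q ∸ 1` is `suc q ∸ 2`.
    (q ℕ.∸ 1) / 2                ≡⟨ ≡.cong (λ n → (n ℕ.∸ 2) / 2) 1+q≡f+a*2 ⟩
    (f ℕ.+ a ℕ.* 2 ℕ.∸ 2) / 2    ≤⟨ /-monoˡ-≤ 2 (ℕ.∸-monoˡ-≤ 2 (ℕ.+-monoˡ-≤ (a ℕ.* 2) f≤2)) ⟩
    a ℕ.* 2 / 2                  ≡⟨ m*n/n≡m a 2 ⟩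
    a                            ∎

  f≤2⇒f+a≤[q+3]/2 : f ≤ 2 → f ℕ.+ a ≤ (q ℕ.+ 3) / 2
  f≤2⇒f+a≤[q+3]/2 f≤2 = begin
    f ℕ.+ a                  ≡⟨ m*n/n≡m (f ℕ.+ a) 2 ⟨
    (f ℕ.+ a) ℕ.* 2 / 2      ≤⟨ /-monoˡ-≤ 2 (begin
      (f ℕ.+ a) ℕ.* 2          ≡⟨ solve 2 (λ f a → (f :+ a) :* con 2 := f :+ (f :+ a :* con 2)) ≡.refl f a ⟩
      f ℕ.+ (f ℕ.+ a ℕ.* 2)    ≡⟨ ≡.cong (f ℕ.+_) 1+q≡f+a*2 ⟨
      f ℕ.+ suc q              ≤⟨ ℕ.+-monoˡ-≤ (suc q) f≤2 ⟩
      2 ℕ.+ suc q              ≡⟨ ℕ.+-comm 3 q ⟩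
      q ℕ.+ 3                  ∎) ⟩
    (q ℕ.+ 3) / 2            ∎
    where open +-*-Solver

-- Finite fields: decidable equality and inverses.

module FiniteField {c ℓ₁ ℓ₂ : Level} {q : ℕ} (F : HeytingField c ℓ₁ ℓ₂)
                   (card : HasCardinality (HeytingField.setoid F) q) where

  open HeytingField F hiding (zero)
  open Inverse card using (to; from; to-cong; strictlyInverseʳ)

  R : CommutativeRing c ℓ₁
  R = HeytingCommutativeRing.commutativeRing heytingCommutativeRing

  open CommutativeRing R using (ring)
  open import Algebra.Properties.Ring ring using (-0#≈0#)
  open IntegerCoefficients R public
  open import Relation.Binary.Reasoning.Setoid setoid

  to-injective : ∀ {x y} → to x ≡ to y → x ≈ y
  to-injective eq = trans (sym (strictlyInverseʳ _)) (trans (reflexive (≡.cong from eq)) (strictlyInverseʳ _))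

  infix 4 _≟_
  _≟_ : ∀ x y → Dec (x ≈ y)
  x ≟ y = map′ to-injective to-cong (to x Fin.≟ to y)

  -- The axioms invert only elements apart from 0#. Invertibility is decidable by search, and by tightness an element
  -- that is not invertible is 0#, so that every x ≉ 0# is invertible.
  private
    inverse? : ∀ x → Dec (∃[ i ] x * from i ≈ 1#)
    inverse? x = Fin.any? (λ i → x * from i ≟ 1#)

  -- The axioms tie `x # 0#` to invertibility of `x - 0#`, not of `x` itself.
  x-0≈x : ∀ x → x - 0# ≈ x
  x-0≈x x = trans (+-congˡ -0#≈0#) (+-identityʳ x)

  infix 8 _⁻¹
  _⁻¹ : Carrier → Carrier
  x ⁻¹ with inverse? x
  ... | yes (i , _) = from i
  ... | no  _       = 0#

  *-inverseʳ : ∀ {x} → ¬ x ≈ 0# → x * x ⁻¹ ≈ 1#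
  *-inverseʳ {x} x≉0 with inverse? x
  ... | yes (_ , eq) = eq
  ... | no ¬inverse  = contradiction (proj₁ (tight x 0#) ¬x#0) x≉0
    where
    ¬x#0 : ¬ x # 0#
    ¬x#0 x#0 with #⇒invertible x#0
    ... | y , _ , xy≈1 = ¬inverse (to y , trans (*-cong (sym (x-0≈x x)) (strictlyInverseʳ y)) xy≈1)

  -- Invertibility of `1#` gives `1# # 0#`, which tightness makes incompatible with equality.
  1≉0 : ¬ 1# ≈ 0#
  1≉0 1≈0 = proj₂ (tight 1# 0#) 1≈0
    (invertible⇒# (1# , trans (*-identityˡ _) (x-0≈x 1#) , trans (*-identityʳ _) (x-0≈x 1#)))

  xy≈0⇒x≈0⊎y≈0 : ∀ {x y} → x * y ≈ 0# → x ≈ 0# ⊎ y ≈ 0#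
  xy≈0⇒x≈0⊎y≈0 {x} {y} xy≈0 with x ≟ 0#
  ... | yes x≈0 = inj₁ x≈0
  ... | no  x≉0 = inj₂ (begin
    y               ≈⟨ *-identityˡ y ⟨
    1# * y          ≈⟨ *-congʳ (*-inverseʳ x≉0) ⟨
    x * x ⁻¹ * y    ≈⟨ solve 3 (λ x z y → x :* z :* y := z :* (x :* y)) refl x (x ⁻¹) y ⟩
    x ⁻¹ * (x * y)  ≈⟨ *-congˡ xy≈0 ⟩
    x ⁻¹ * 0#       ≈⟨ zeroʳ _ ⟩
    0#              ∎)

  xx≈0⇒x≈0 : ∀ {x} → x * x ≈ 0# → x ≈ 0#
  xx≈0⇒x≈0 = [ id , id ]′ ∘ xy≈0⇒x≈0⊎y≈0

-- Finite fields of odd order.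

module OddField {c ℓ₁ ℓ₂ : Level} {q : ℕ} (2∤q : ¬ 2 ∣ q) (F : HeytingField c ℓ₁ ℓ₂)
                (card : HasCardinality (HeytingField.setoid F) q) where

  open HeytingField F hiding (zero)
  open Inverse card using (to; from; to-cong; strictlyInverseˡ; strictlyInverseʳ)
  open FiniteField F card
  open Plane F
  open CommutativeRing R using (ring)
  open import Algebra.Properties.Ring ring using (-0#≈0#; x∙y⁻¹≈ε⇒x≈y; x≈y⇒x∙y⁻¹≈ε; -‿involutive)
  open import Relation.Binary.Reasoning.Setoid setoid

  -- Otherwise adding `1#` would be an involution without fixed points, and `q` would be even.
  1+1≉0 : ¬ 1# + 1# ≈ 0#
  1+1≉0 1+1≈0 = 2∤q (free-involution⇒even σ σσ≡id σ-free)
    where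
    σ : Fin q → Fin q
    σ i = to (from i + 1#)
    σσ≡id : ∀ i → σ (σ i) ≡ i
    σσ≡id i = ≡.trans (to-cong (begin
      from (σ i) + 1#     ≈⟨ +-congʳ (strictlyInverseʳ _) ⟩
      from i + 1# + 1#    ≈⟨ +-assoc _ _ _ ⟩
      from i + (1# + 1#)  ≈⟨ +-congˡ 1+1≈0 ⟩
      from i + 0#         ≈⟨ +-identityʳ _ ⟩
      from i              ∎)) (strictlyInverseˡ i)
    σ-free : ∀ i → σ i ≢ i
    σ-free i σi≡i = 1≉0 (begin
      1#                    ≈⟨ solve 2 (λ x y → y := x :+ y :- x) refl (from i) 1# ⟩
      from i + 1# - from i  ≈⟨ +-congʳ (trans (sym (strictlyInverseʳ _)) (reflexive (≡.cong from σi≡i))) ⟩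
      from i - from i       ≈⟨ -‿inverseʳ _ ⟩
      0#                    ∎)

  x+x≈0⇒x≈0 : ∀ {x} → x + x ≈ 0# → x ≈ 0#
  x+x≈0⇒x≈0 {x} x+x≈0 with xy≈0⇒x≈0⊎y≈0 {1# + 1#} {x}
    (trans (solve 1 (λ x → (con (ℤ.+ 1) :+ con (ℤ.+ 1)) :* x := x :+ x) refl x) x+x≈0)
  ... | inj₁ 1+1≈0 = contradiction 1+1≈0 1+1≉0
  ... | inj₂ x≈0   = x≈0

  -- Vector algebra of the plane.

  infixl 6 _⊟_
  _⊟_ : Point → Point → Point
  (a , b) ⊟ (c , d) = a - c , b - d

  infixr 7 _·_
  _·_ : Carrier → Point → Point
  k · (a , b) = k * a , k * b

  -- The conjugate of `u` times `v` in `F[i]` is `dot u v + i cross u v`.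
  cross dot : Point → Point → Carrier
  cross (a , b) (c , d) = a * d - b * c
  dot   (a , b) (c , d) = a * c + b * d

  -- By computation `d² u v` is `norm (u ⊟ v)`.
  norm : Point → Carrier
  norm (a , b) = a * a + b * b

  -- Multiplication by i, multiplication by 1 + i and squaring in F[i].
  rot diag dbl : Point → Point
  rot  (a , b) = - b , a
  diag (a , b) = a - b , a + b
  dbl  (a , b) = a * a - b * b , a * b + a * b

  -- The operations repeated on polynomial expressions, so that identities can be stated to the ring
  -- solver in vector form.
  Pointᵖ : ℕ → Set
  Pointᵖ n = Polynomial n × Polynomial n

  infixl 6 _⊟ᵖ_
  _⊟ᵖ_ : ∀ {n} → Pointᵖ n → Pointᵖ n → Pointᵖ n
  (a , b) ⊟ᵖ (c , d) = a :- c , b :- d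

  infixr 7 _·ᵖ_
  _·ᵖ_ : ∀ {n} → Polynomial n → Pointᵖ n → Pointᵖ n
  k ·ᵖ (a , b) = k :* a , k :* b

  crossᵖ dotᵖ : ∀ {n} → Pointᵖ n → Pointᵖ n → Polynomial n
  crossᵖ (a , b) (c , d) = a :* d :- b :* c
  dotᵖ   (a , b) (c , d) = a :* c :+ b :* d

  normᵖ : ∀ {n} → Pointᵖ n → Polynomial n
  normᵖ (a , b) = a :* a :+ b :* b

  rotᵖ diagᵖ dblᵖ : ∀ {n} → Pointᵖ n → Pointᵖ n
  rotᵖ  (a , b) = :- b , a
  diagᵖ (a , b) = a :- b , a :+ b
  dblᵖ  (a , b) = a :* a :- b :* b , a :* b :+ a :* b

  cross-cong : ∀ {u u′ v v′} → u ≈ₚ u′ → v ≈ₚ v′ → cross u v ≈ cross u′ v′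
  cross-cong (a , b) (c , d) = +-cong (*-cong a d) (-‿cong (*-cong b c))

  ⊟-cong : ∀ {u u′ v v′} → u ≈ₚ u′ → v ≈ₚ v′ → u ⊟ v ≈ₚ u′ ⊟ v′
  ⊟-cong (a , b) (c , d) = +-cong a (-‿cong c) , +-cong b (-‿cong d)

  norm-cong : ∀ {u v} → u ≈ₚ v → norm u ≈ norm v
  norm-cong (a , b) = +-cong (*-cong a a) (*-cong b b)

  infix 4 _≟ₚ_
  _≟ₚ_ : ∀ u v → Dec (u ≈ₚ v)
  (a , b) ≟ₚ (c , d) = (a ≟ c) ×-dec (b ≟ d)

  ≈ₚ-refl : ∀ {u} → u ≈ₚ u
  ≈ₚ-refl = refl , refl

  ≈ₚ-sym : ∀ {u v} → u ≈ₚ v → v ≈ₚ u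
  ≈ₚ-sym (a , b) = sym a , sym b

  ≈ₚ-trans : ∀ {u v w} → u ≈ₚ v → v ≈ₚ w → u ≈ₚ w
  ≈ₚ-trans (a , b) (c , d) = trans a c , trans b d

  NonZero : Point → Set ℓ₁
  NonZero v = ¬ v ≈ₚ (0# , 0#)

  nonZero-coordinate : ∀ {v} → NonZero v → ¬ proj₁ v ≈ 0# ⊎ ¬ proj₂ v ≈ 0#
  nonZero-coordinate {a , b} v≉0 with a ≟ 0#
  ... | no  a≉0 = inj₁ a≉0
  ... | yes a≈0 = inj₂ (λ b≈0 → v≉0 (a≈0 , b≈0))

  ⊟-nonZero : ∀ {u v} → ¬ u ≈ₚ v → NonZero (u ⊟ v)
  ⊟-nonZero u≉v (a≈0 , b≈0) = u≉v (x∙y⁻¹≈ε⇒x≈y _ _ a≈0 , x∙y⁻¹≈ε⇒x≈y _ _ b≈0)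

  diag-nonZero : ∀ {v} → NonZero v → NonZero (diag v)
  diag-nonZero {a , b} v≉0 (a-b≈0 , a+b≈0) = v≉0 (a≈0 , trans (sym a≈b) a≈0)
    where
    a≈b : a ≈ b
    a≈b = x∙y⁻¹≈ε⇒x≈y _ _ a-b≈0
    a≈0 : a ≈ 0#
    a≈0 = x+x≈0⇒x≈0 (trans (+-congˡ a≈b) a+b≈0)

  rot-nonZero : ∀ {v} → NonZero v → NonZero (rot v)
  rot-nonZero v≉0 (-b≈0 , a≈0) = v≉0 (a≈0 , trans (sym (-‿involutive _)) (trans (-‿cong -b≈0) -0#≈0#))

  -- `F[i]` has no nilpotent elements, even when it has zero divisors: `2 a b = 0` kills one
  -- coordinate, and `a² = b²` then kills the other.
  dbl-nonZero : ∀ {v} → NonZero v → NonZero (dbl v)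
  dbl-nonZero {a , b} v≉0 (aa-bb≈0 , ab+ab≈0) with xy≈0⇒x≈0⊎y≈0 (x+x≈0⇒x≈0 ab+ab≈0)
  ... | inj₁ a≈0 = v≉0 (a≈0 , xx≈0⇒x≈0 (trans (sym (x∙y⁻¹≈ε⇒x≈y _ _ aa-bb≈0)) (trans (*-congʳ a≈0) (zeroˡ a))))
  ... | inj₂ b≈0 = v≉0 (xx≈0⇒x≈0 (trans (x∙y⁻¹≈ε⇒x≈y _ _ aa-bb≈0) (trans (*-congʳ b≈0) (zeroˡ b))) , b≈0)

  -- Parallel vectors.

  infix 4 _∥_
  _∥_ : Point → Point → Set ℓ₁
  u ∥ v = cross u v ≈ 0#

  ∥-sym : ∀ {u v} → u ∥ v → v ∥ u
  ∥-sym {a , b} {c , d} u∥v = trans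
    (solve 4 (λ a b c d → crossᵖ (c , d) (a , b) := :- crossᵖ (a , b) (c , d)) refl a b c d)
    (trans (-‿cong u∥v) -0#≈0#)

  -- The middle vector is nonzero because the origin is parallel to everything. A coordinate of `v`
  -- times `cross u w` is a linear combination of `cross u v` and `cross v w`.
  ∥-trans : ∀ {u v w} → NonZero v → u ∥ v → v ∥ w → u ∥ w
  ∥-trans {a , b} {c , d} {e , f} v≉0 u∥v v∥w with nonZero-coordinate v≉0
  ... | inj₁ c≉0 = [ (λ c≈0 → contradiction c≈0 c≉0) , id ]′ (xy≈0⇒x≈0⊎y≈0 (begin
    c * (a * f - b * e)
      ≈⟨ solve 6 (λ a b c d e f → let u = a , b; v = c , d; w = e , f in
           c :* crossᵖ u w := crossᵖ u v :* e :+ crossᵖ v w :* a) refl a b c d e f ⟩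
    (a * d - b * c) * e + (c * f - d * e) * a  ≈⟨ +-cong (*-congʳ u∥v) (*-congʳ v∥w) ⟩
    0# * e + 0# * a                            ≈⟨ +-cong (zeroˡ e) (zeroˡ a) ⟩
    0# + 0#                                    ≈⟨ +-identityˡ 0# ⟩
    0#                                         ∎))
  ... | inj₂ d≉0 = [ (λ d≈0 → contradiction d≈0 d≉0) , id ]′ (xy≈0⇒x≈0⊎y≈0 (begin
    d * (a * f - b * e)
      ≈⟨ solve 6 (λ a b c d e f → let u = a , b; v = c , d; w = e , f in
           d :* crossᵖ u w := crossᵖ u v :* f :+ crossᵖ v w :* b) refl a b c d e f ⟩
    (a * d - b * c) * f + (c * f - d * e) * b  ≈⟨ +-cong (*-congʳ u∥v) (*-congʳ v∥w) ⟩
    0# * f + 0# * b                            ≈⟨ +-cong (zeroˡ f) (zeroˡ b) ⟩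
    0# + 0#                                    ≈⟨ +-identityˡ 0# ⟩
    0#                                         ∎))

  ∥⇒multiple : ∀ {u v} → NonZero u → u ∥ v → ∃[ t ] v ≈ₚ t · u
  ∥⇒multiple {a , b} {c , d} u≉0 u∥v with nonZero-coordinate u≉0
  ... | inj₁ a≉0 = a ⁻¹ * c , (begin
    c                ≈⟨ *-identityˡ c ⟨
    1# * c           ≈⟨ *-congʳ (*-inverseʳ a≉0) ⟨
    a * a ⁻¹ * c     ≈⟨ solve 3 (λ a i c → a :* i :* c := i :* c :* a) refl a (a ⁻¹) c ⟩
    a ⁻¹ * c * a     ∎) , (begin
    d                ≈⟨ *-identityˡ d ⟨
    1# * d           ≈⟨ *-congʳ (*-inverseʳ a≉0) ⟨
    a * a ⁻¹ * d     ≈⟨ solve 3 (λ a i d → a :* i :* d := i :* (a :* d)) refl a (a ⁻¹) d ⟩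
    a ⁻¹ * (a * d)   ≈⟨ *-congˡ (x∙y⁻¹≈ε⇒x≈y _ _ u∥v) ⟩
    a ⁻¹ * (b * c)   ≈⟨ solve 3 (λ i b c → i :* (b :* c) := i :* c :* b) refl (a ⁻¹) b c ⟩
    a ⁻¹ * c * b     ∎)
  ... | inj₂ b≉0 = b ⁻¹ * d , (begin
    c                ≈⟨ *-identityˡ c ⟨
    1# * c           ≈⟨ *-congʳ (*-inverseʳ b≉0) ⟨
    b * b ⁻¹ * c     ≈⟨ solve 3 (λ b i c → b :* i :* c := i :* (b :* c)) refl b (b ⁻¹) c ⟩
    b ⁻¹ * (b * c)   ≈⟨ *-congˡ (x∙y⁻¹≈ε⇒x≈y _ _ u∥v) ⟨
    b ⁻¹ * (a * d)   ≈⟨ solve 3 (λ i a d → i :* (a :* d) := i :* d :* a) refl (b ⁻¹) a d ⟩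
    b ⁻¹ * d * a     ∎) , (begin
    d                ≈⟨ *-identityˡ d ⟨
    1# * d           ≈⟨ *-congʳ (*-inverseʳ b≉0) ⟨
    b * b ⁻¹ * d     ≈⟨ solve 3 (λ b i d → b :* i :* d := i :* d :* b) refl b (b ⁻¹) d ⟩
    b ⁻¹ * d * b     ∎)

  -- Parallelism under multiplication by `1 + i`, by `i`, and under squaring.

  double≈0 : ∀ {x y} → x ≈ y + y → y ≈ 0# → x ≈ 0#
  double≈0 x≈y+y y≈0 = trans x≈y+y (trans (+-cong y≈0 y≈0) (+-identityˡ 0#))

  -- Multiplication by `1 + i` is linear of determinant 2, so it doubles `cross`.
  diag-∥ : ∀ {u v} → u ∥ v → diag u ∥ diag v
  diag-∥ {a , b} {c , d} = double≈0
    (solve 4 (λ a b c d → let x = crossᵖ (a , b) (c , d) in crossᵖ (diagᵖ (a , b)) (diagᵖ (c , d)) := x :+ x) refl a b c d)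

  rot-∥ : ∀ {u v} → u ∥ v → rot u ∥ rot v
  rot-∥ {a , b} {c , d} = trans
    (solve 4 (λ a b c d → crossᵖ (rotᵖ (a , b)) (rotᵖ (c , d)) := crossᵖ (a , b) (c , d)) refl a b c d)

  -- Because `(1 + i)² = 2 i`.
  diag²∥rot : ∀ v → diag (diag v) ∥ rot v
  diag²∥rot (a , b) = trans
    (solve 2 (λ a b → crossᵖ (diagᵖ (diagᵖ (a , b))) (rotᵖ (a , b)) := a :- a) refl a b) (-‿inverseʳ a)

  rot²∥id : ∀ v → rot (rot v) ∥ v
  rot²∥id (a , b) = trans
    (solve 2 (λ a b → crossᵖ (rotᵖ (rotᵖ (a , b))) (a , b) := a :- a) refl a b) (-‿inverseʳ a)

  -- Because `(i v)² = - v²`.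
  dbl-rot∥dbl : ∀ v → dbl (rot v) ∥ dbl v
  dbl-rot∥dbl (a , b) = trans
    (solve 2 (λ a b → crossᵖ (dblᵖ (rotᵖ (a , b))) (dblᵖ (a , b)) := a :- a) refl a b) (-‿inverseʳ a)

  cross-rotʳ : ∀ v → cross v (rot v) ≈ norm v
  cross-rotʳ (a , b) = solve 2 (λ a b → crossᵖ (a , b) (rotᵖ (a , b)) := normᵖ (a , b)) refl a b

  dot≈0⇒rot∥ : ∀ {u v} → dot u v ≈ 0# → rot u ∥ v
  dot≈0⇒rot∥ {a , b} {c , d} u⊥v = trans
    (solve 4 (λ a b c d → crossᵖ (rotᵖ (a , b)) (c , d) := :- dotᵖ (a , b) (c , d)) refl a b c d)
    (trans (-‿cong u⊥v) -0#≈0#)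

  -- The imaginary part of `(dot u v + i cross u v)²`.
  cross-dbl : ∀ u v → cross (dbl u) (dbl v) ≈ cross u v * dot u v + cross u v * dot u v
  cross-dbl (a , b) (c , d) = solve 4
    (λ a b c d → let x = crossᵖ (a , b) (c , d) :* dotᵖ (a , b) (c , d) in crossᵖ (dblᵖ (a , b)) (dblᵖ (c , d)) := x :+ x)
    refl a b c d

  dbl-∥ : ∀ {u v} → u ∥ v → dbl u ∥ dbl v
  dbl-∥ {u} {v} u∥v = double≈0 (cross-dbl u v) (trans (*-congʳ u∥v) (zeroˡ _))

  -- In `cross-dbl` either `cross` or `dot` must vanish, and a vector orthogonal to `u` is parallel
  -- to `i u`.
  dbl-∥⁻¹ : ∀ {u v} → dbl u ∥ dbl v → u ∥ v ⊎ rot u ∥ v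
  dbl-∥⁻¹ {u} {v} dbl∥dbl = [ inj₁ , inj₂ ∘ dot≈0⇒rot∥ {u} {v} ]′
    (xy≈0⇒x≈0⊎y≈0 {cross u v} {dot u v} (x+x≈0⇒x≈0 {cross u v * dot u v} (trans (sym (cross-dbl u v)) dbl∥dbl)))

  -- The projective line of directions.

  -- Projective line: zero is the point at infinity (1 : 0) and suc i is (from i : 1).
  rep : Fin (suc q) → Point
  rep zero    = 1# , 0#
  rep (suc i) = from i , 1#

  -- The junk value at the origin is the point at infinity.
  proj : Point → Fin (suc q)
  proj (a , b) with b ≟ 0#
  ... | yes _ = zero
  ... | no  _ = suc (to (a * b ⁻¹))

  rep-nonZero : ∀ x → NonZero (rep x)
  rep-nonZero zero    (1≈0 , _) = 1≉0 1≈0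
  rep-nonZero (suc i) (_ , 1≈0) = 1≉0 1≈0

  -- Valid at the origin too, which is parallel to every vector.
  rep-proj : ∀ v → rep (proj v) ∥ v
  rep-proj (a , b) with b ≟ 0#
  ... | yes b≈0 = begin
    1# * b - 0# * a  ≈⟨ +-cong (*-identityˡ b) (trans (-‿cong (zeroˡ a)) -0#≈0#) ⟩
    b + 0#           ≈⟨ +-identityʳ b ⟩
    b                ≈⟨ b≈0 ⟩
    0#               ∎
  ... | no b≉0 = begin
    from (to (a * b ⁻¹)) * b - 1# * a  ≈⟨ +-cong (*-congʳ (strictlyInverseʳ _)) (-‿cong (*-identityˡ a)) ⟩
    a * b ⁻¹ * b - a                   ≈⟨ solve 3 (λ a b i → a :* i :* b :- a := a :* (b :* i) :- a) refl a b (b ⁻¹) ⟩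
    a * (b * b ⁻¹) - a                 ≈⟨ +-congʳ (*-congˡ (*-inverseʳ b≉0)) ⟩
    a * 1# - a                         ≈⟨ +-congʳ (*-identityʳ a) ⟩
    a - a                              ≈⟨ -‿inverseʳ a ⟩
    0#                                 ∎

  rep-injective : ∀ {x y} → rep x ∥ rep y → x ≡ y
  rep-injective {zero}  {zero}  _  = ≡.refl
  rep-injective {zero}  {suc j} eq = contradiction (trans (sym (begin
    1# * 1# - 0# * from j  ≈⟨ +-cong (*-identityˡ 1#) (trans (-‿cong (zeroˡ _)) -0#≈0#) ⟩
    1# + 0#                ≈⟨ +-identityʳ 1# ⟩
    1#                     ∎)) eq) 1≉0
  rep-injective {suc i} {zero}  eq = ≡.sym (rep-injective {zero} {suc i} (∥-sym {rep (suc i)} {rep zero} eq))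
  rep-injective {suc i} {suc j} eq = ≡.cong suc (≡.trans (≡.sym (strictlyInverseˡ i)) (≡.trans (to-cong (x∙y⁻¹≈ε⇒x≈y _ _ (begin
    from i - from j            ≈⟨ +-cong (*-identityʳ _) (-‿cong (*-identityˡ _)) ⟨
    from i * 1# - 1# * from j  ≈⟨ eq ⟩
    0#                         ∎))) (strictlyInverseˡ j)))

  ∥⇒proj≡ : ∀ {u v} → NonZero u → NonZero v → u ∥ v → proj u ≡ proj v
  ∥⇒proj≡ {u} {v} u≉0 v≉0 u∥v = rep-injective
    (∥-trans {rep (proj u)} {u} {rep (proj v)} u≉0 (rep-proj u)
      (∥-trans {u} {v} {rep (proj v)} v≉0 u∥v (∥-sym {rep (proj v)} {v} (rep-proj v))))

  proj≡⇒∥ : ∀ {u v} → proj u ≡ proj v → u ∥ v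
  proj≡⇒∥ {u} {v} eq = ∥-trans {u} {rep (proj u)} {v} (rep-nonZero (proj u)) (∥-sym {rep (proj u)} {u} (rep-proj u))
    (≡.subst (λ x → rep x ∥ v) (≡.sym eq) (rep-proj v))

  ρ : Fin (suc q) → Fin (suc q)
  ρ x = proj (diag (rep x))

  -- Multiplying twice by `1 + i` is multiplying by `2 i`, which on directions is multiplication by
  -- `i`. Taking representatives in between only rescales the vectors.
  rep-ρρ : ∀ x → rep (ρ (ρ x)) ∥ rot (rep x)
  rep-ρρ x = ∥-trans {rep (ρ (ρ x))} {diag (rep (ρ x))} {rot (rep x)} (diag-nonZero (rep-nonZero (ρ x))) (rep-proj _)
    (∥-trans {diag (rep (ρ x))} {diag (diag (rep x))} {rot (rep x)} (diag-nonZero (diag-nonZero (rep-nonZero x)))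
      (diag-∥ {rep (ρ x)} {diag (rep x)} (rep-proj _)) (diag²∥rot (rep x)))

  rot∥⇒ρρ≡ : ∀ {x y} → rot (rep x) ∥ rep y → ρ (ρ x) ≡ y
  rot∥⇒ρρ≡ {x} {y} eq = rep-injective
    (∥-trans {rep (ρ (ρ x))} {rot (rep x)} {rep y} (rot-nonZero (rep-nonZero x)) (rep-ρρ x) eq)

  ρ⁴≡id : ∀ x → ρ (ρ (ρ (ρ x))) ≡ x
  ρ⁴≡id x = rot∥⇒ρρ≡ {ρ (ρ x)} {x}
    (∥-trans {rot (rep (ρ (ρ x)))} {rot (rot (rep x))} {rep x} (rot-nonZero (rot-nonZero (rep-nonZero x)))
      (rot-∥ {rep (ρ (ρ x))} {rot (rep x)} (rep-ρρ x)) (rot²∥id (rep x)))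

  open OrderFour ρ ρ⁴≡id public

  -- Since `cross v (i v) = norm v`, a direction is fixed by multiplication by `i` exactly when it
  -- is isotropic.
  norm≈0⇒fixed : ∀ {x} → norm (rep x) ≈ 0# → τ x ≡ x
  norm≈0⇒fixed {x} norm≈0 = rot∥⇒ρρ≡ {x} {x} (∥-sym {rep x} {rot (rep x)} (trans (cross-rotʳ (rep x)) norm≈0))

  fixed⇒norm≈0 : ∀ {x} → τ x ≡ x → norm (rep x) ≈ 0#
  fixed⇒norm≈0 {x} fixed = trans (sym (cross-rotʳ (rep x))) (≡.subst (λ y → rep y ∥ rot (rep x)) fixed (rep-ρρ x))

  -- Directions of squares, and integral directions.

  sq : Fin (suc q) → Fin (suc q)
  sq x = proj (dbl (rep x))

  sq∘τ≡sq : ∀ x → sq (τ x) ≡ sq x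
  sq∘τ≡sq x = ∥⇒proj≡ (dbl-nonZero (rep-nonZero (τ x))) (dbl-nonZero (rep-nonZero x))
    (∥-trans {dbl (rep (τ x))} {dbl (rot (rep x))} {dbl (rep x)} (dbl-nonZero (rot-nonZero (rep-nonZero x)))
      (dbl-∥ {rep (τ x)} {rot (rep x)} (rep-ρρ x)) (dbl-rot∥dbl (rep x)))

  open Image sq∘τ≡sq public

  dbl∥⇒∈Image : ∀ {w v} → NonZero w → NonZero v → dbl w ∥ v → ∃[ x ] sq x ≡ proj v
  dbl∥⇒∈Image {w} {v} w≉0 v≉0 eq = proj w , ∥⇒proj≡ (dbl-nonZero (rep-nonZero (proj w))) v≉0
    (∥-trans {dbl (rep (proj w))} {dbl w} {v} (dbl-nonZero w≉0) (dbl-∥ {rep (proj w)} {w} (rep-proj w)) eq)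

  -- Pythagorean parametrisation: if a² + b² = c² then (a + c + b i)² is a multiple of a + b i, unless a + c + b i = 0.
  integral⇒∈Image : ∀ {v} → NonZero v → IsSquare (norm v) → ∃[ x ] sq x ≡ proj v
  integral⇒∈Image {a , b} v≉0 (c , norm≈cc) with (a + c , b) ≟ₚ (0# , 0#)
  ... | no w≉0 = dbl∥⇒∈Image {a + c , b} w≉0 v≉0 (begin
    cross (dbl (a + c , b)) (a , b)
      ≈⟨ solve 3 (λ a b c → crossᵖ (dblᵖ (a :+ c , b)) (a , b) := :- (b :* (normᵖ (a , b) :- c :* c))) refl a b c ⟩
    - (b * (norm (a , b) - c * c))
      ≈⟨ -‿cong (*-congˡ (x≈y⇒x∙y⁻¹≈ε norm≈cc)) ⟩
    - (b * 0#)  ≈⟨ -‿cong (zeroʳ b) ⟩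
    - 0#        ≈⟨ -0#≈0# ⟩
    0#          ∎)
  ... | yes (_ , b≈0) = dbl∥⇒∈Image {1# , 0#} (λ (1≈0 , _) → 1≉0 1≈0) v≉0 (begin
    (1# * 1# - 0# * 0#) * b - (1# * 0# + 1# * 0#) * a
      ≈⟨ +-cong (*-congˡ b≈0) (-‿cong (*-congʳ (trans (+-cong (zeroʳ 1#) (zeroʳ 1#)) (+-identityˡ 0#)))) ⟩
    (1# * 1# - 0# * 0#) * 0# - 0# * a  ≈⟨ +-cong (zeroʳ _) (trans (-‿cong (zeroˡ a)) -0#≈0#) ⟩
    0# + 0#                            ≈⟨ +-identityˡ 0# ⟩
    0#                                 ∎)

  -- Collinearity and arcs.

  collinear⇒∥ : ∀ {u v w} → Collinear u v w → u ⊟ v ∥ u ⊟ w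
  collinear⇒∥ (L , (r , u≈) , (s , v≈) , (t , w≈)) with Line.base L | Line.direction L
  ... | a , b | d , e = trans (cross-cong (⊟-cong u≈ v≈) (⊟-cong u≈ w≈)) (trans
    (solve 7 (λ a b d e r s t → let pt = λ x → a :+ x :* d , b :+ x :* e in
      crossᵖ (pt r ⊟ᵖ pt s) (pt r ⊟ᵖ pt t) := a :- a) refl a b d e r s t)
    (-‿inverseʳ a))

  ∥⇒collinear : ∀ {u v w} → ¬ u ≈ₚ v → u ⊟ v ∥ u ⊟ w → Collinear u v w
  ∥⇒collinear {a , b} {c , d} {e , f} u≉v u-v∥u-w with ∥⇒multiple {a - c , b - d} {a - e , b - f} (⊟-nonZero u≉v) u-v∥u-w
  ... | t , a-e≈ , b-f≈ =
    -- The line through `u` in direction `u - v`: as `v = u - (u - v)` and `w = u - t (u - v)`, the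
    -- parameters are `0`, `-1` and `-t`.
    record { base = a , b ; direction = a - c , b - d ; nonzero = ⊟-nonZero u≉v } ,
    (0# , at-0 a (a - c) , at-0 b (b - d)) ,
    (- 1# , at-minus-1 a c , at-minus-1 b d) ,
    (- t , at-minus-t a-e≈ , at-minus-t b-f≈)
    where
    at-0 : ∀ x y → x ≈ x + 0# * y
    at-0 x y = sym (trans (+-congˡ (zeroˡ y)) (+-identityʳ x))
    at-minus-1 : ∀ x y → y ≈ x + - 1# * (x - y)
    at-minus-1 x y = solve 2 (λ x y → y := x :+ :- con (ℤ.+ 1) :* (x :- y)) refl x y
    at-minus-t : ∀ {x y z} → x - y ≈ t * z → y ≈ x + - t * z
    at-minus-t {x} {y} {z} x-y≈tz = begin
      y              ≈⟨ solve 2 (λ x y → y := x :+ :- (x :- y)) refl x y ⟩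
      x - (x - y)    ≈⟨ +-congˡ (-‿cong x-y≈tz) ⟩
      x - t * z      ≈⟨ solve 3 (λ x t z → x :- t :* z := x :+ :- t :* z) refl x t z ⟩
      x + - t * z    ∎

  -- The conditions of `Attained`, with distinctness read off the indices and collinearity off a
  -- determinant, so that a finite search decides them.
  IsArc : ∀ {m} → (Fin m → Point) → Set (c ⊔ ℓ₁)
  IsArc f = (∀ i j → f i ≈ₚ f j → i ≡ j)
          × (∀ i j → AtIntegralDistance (f i) (f j))
          × (∀ i j k → i ≢ j → i ≢ k → j ≢ k → ¬ (f i ⊟ f j ∥ f i ⊟ f k))

  attained⇒arc : ∀ {m} → Attained m → ∃[ f ] IsArc {m} f
  attained⇒arc (P , integral , noThree) = f , (λ _ _ → injective) , integral , λ i j k i≢j i≢k j≢k i-j∥i-k →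
    noThree i j k (i≢j ∘ injective) (i≢k ∘ injective) (j≢k ∘ injective)
      (∥⇒collinear {f i} {f j} {f k} (i≢j ∘ injective) i-j∥i-k)
    where open Injection P using (injective) renaming (to to f)

  arc⇒attained : ∀ {m} {f : Fin m → Point} → IsArc f → Attained m
  arc⇒attained {f = f} (injective , integral , noThree) =
    record { to = f ; cong = λ { ≡.refl → ≈ₚ-refl } ; injective = injective _ _ } , integral ,
    λ i j k i≉j i≉k j≉k collinear → noThree i j k
      (λ { ≡.refl → i≉j ≈ₚ-refl }) (λ { ≡.refl → i≉k ≈ₚ-refl }) (λ { ≡.refl → j≉k ≈ₚ-refl })
      (collinear⇒∥ {f i} {f j} {f k} collinear)

  -- For use with encoded maps, which decoding recovers only up to `≈ₚ`.
  arc-cong : ∀ {m} {f g : Fin m → Point} → (∀ i → f i ≈ₚ g i) → IsArc f → IsArc g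
  arc-cong {f = f} {g} f≈g (injective , integral , noThree) =
    (λ i j gi≈gj → injective i j (≈ₚ-trans (f≈g i) (≈ₚ-trans gi≈gj (≈ₚ-sym (f≈g j))))) ,
    (λ i j → let t , d²≈tt = integral i j in t , trans (norm-cong (⊟-cong (≈ₚ-sym (f≈g i)) (≈ₚ-sym (f≈g j)))) d²≈tt) ,
    λ i j k i≢j i≢k j≢k g∥ → noThree i j k i≢j i≢k j≢k
      (trans (cross-cong (⊟-cong (f≈g i) (f≈g j)) (⊟-cong (f≈g i) (f≈g k))) g∥)

  -- Decidability of `Attained`.

  isSquare? : ∀ x → Dec (IsSquare x)
  isSquare? x = map′ (λ (i , eq) → from i , eq)
    (λ (t , x≈tt) → to t , trans x≈tt (sym (*-cong (strictlyInverseʳ t) (strictlyInverseʳ t))))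
    (Fin.any? (λ i → x ≟ from i * from i))

  isArc? : ∀ {m} (f : Fin m → Point) → Dec (IsArc f)
  isArc? f =
    Fin.all? (λ i → Fin.all? (λ j → (f i ≟ₚ f j) →-dec (i Fin.≟ j)))
    ×-dec Fin.all? (λ i → Fin.all? (λ j → isSquare? (d² (f i) (f j))))
    ×-dec Fin.all? (λ i → Fin.all? (λ j → Fin.all? (λ k →
      ¬? (i Fin.≟ j) →-dec ¬? (i Fin.≟ k) →-dec ¬? (j Fin.≟ k) →-dec ¬? (cross (f i ⊟ f j) (f i ⊟ f k) ≟ 0#))))

  -- Maps Fin m → Point are coded, up to ≈ₚ, by numbers below (q * q) ^ m, which makes the search finite.
  attained? : ∀ m → Dec (Attained m)
  attained? m = map′ (λ (_ , arc) → arc⇒attained arc)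
    (λ attained → let f , arc = attained⇒arc attained in encode f , arc-cong (decode-encode f) arc)
    (Fin.any? (isArc? ∘ decode))
    where
    point : Fin q × Fin q → Point
    point (i , j) = from i , from j
    decode : Fin ((q ℕ.* q) ℕ.^ m) → Fin m → Point
    decode k i = point (Fin.remQuot q (Fin.finToFun k i))
    code : Point → Fin (q ℕ.* q)
    code (a , b) = Fin.combine (to a) (to b)
    encode : (Fin m → Point) → Fin ((q ℕ.* q) ℕ.^ m)
    encode f = Fin.funToFin (code ∘ f)
    point-code : ∀ u → u ≈ₚ point (Fin.remQuot q (code u))
    point-code (a , b) = ≡.subst (λ ij → (a , b) ≈ₚ point ij) (≡.sym (Fin.remQuot-combine (to a) (to b)))
      (sym (strictlyInverseʳ a) , sym (strictlyInverseʳ b))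
    decode-encode : ∀ f i → f i ≈ₚ decode (encode f) i
    decode-encode f i = ≡.subst (λ k → f i ≈ₚ point (Fin.remQuot q k))
      (≡.sym (Fin.finToFun-funToFin (code ∘ f) i)) (point-code (f i))

  -- Lower bound: squares of points of the unit circle.

  -- The norm of `u² - v² = (u - v) (u + v)` is `(norm u + norm v)² - 4 (dot u v)²`; then apply
  -- Lagrange's identity `norm u * norm v = (dot u v)² + (cross u v)²`.
  d²-dbl : ∀ u v → d² (dbl u) (dbl v) ≈
           (norm u - norm v) * (norm u - norm v) + (cross u v + cross u v) * (cross u v + cross u v)
  d²-dbl (a , b) (c , d) = solve 4 (λ a b c d →
    let u = a , b; v = c , d; n = normᵖ u :- normᵖ v; x = crossᵖ u v in
    normᵖ (dblᵖ u ⊟ᵖ dblᵖ v) := n :* n :+ (x :+ x) :* (x :+ x)) refl a b c d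

  -- A Vandermonde determinant: u ↦ (norm u , dbl u) is the Veronese map, up to a linear change of coordinates.
  norm-cross-dbl : ∀ u v w →
    let p = cross u v * cross v w * cross u w in
    norm u * cross (dbl v) (dbl w) + norm v * cross (dbl w) (dbl u) + norm w * cross (dbl u) (dbl v) ≈ (p + p) + (p + p)
  norm-cross-dbl (a , b) (c , d) (e , f) = solve 6 (λ a b c d e f →
    let u = a , b; v = c , d; w = e , f; p = crossᵖ u v :* crossᵖ v w :* crossᵖ u w in
    normᵖ u :* crossᵖ (dblᵖ v) (dblᵖ w) :+ normᵖ v :* crossᵖ (dblᵖ w) (dblᵖ u) :+ normᵖ w :* crossᵖ (dblᵖ u) (dblᵖ v)
      := (p :+ p) :+ (p :+ p)) refl a b c d e f

  -- The determinant with rows `(1 , u)`, `(1 , v)`, `(1 , w)`. Applied to squares of unit vectors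
  -- it agrees with the left side of `norm-cross-dbl`.
  cross-⊟ : ∀ u v w → cross (u ⊟ v) (u ⊟ w) ≈ cross v w + cross w u + cross u v
  cross-⊟ (a , b) (c , d) (e , f) = solve 6 (λ a b c d e f → let u = a , b; v = c , d; w = e , f in
    crossᵖ (u ⊟ᵖ v) (u ⊟ᵖ w) := crossᵖ v w :+ crossᵖ w u :+ crossᵖ u v) refl a b c d e f

  module _ {u v : Point} (norm-u≈1 : norm u ≈ 1#) (norm-v≈1 : norm v ≈ 1#) where

    d²-dbl-unit : d² (dbl u) (dbl v) ≈ (cross u v + cross u v) * (cross u v + cross u v)
    d²-dbl-unit = trans (d²-dbl u v) (trans (+-congʳ (trans (*-congʳ n-m≈0) (zeroˡ (norm u - norm v)))) (+-identityˡ _))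
      where
      n-m≈0 : norm u - norm v ≈ 0#
      n-m≈0 = x≈y⇒x∙y⁻¹≈ε (trans norm-u≈1 (sym norm-v≈1))

    dbl-unit-injective : dbl u ≈ₚ dbl v → u ∥ v
    dbl-unit-injective (a≈ , b≈) = x+x≈0⇒x≈0 {cross u v} (xx≈0⇒x≈0 {cross u v + cross u v} (trans (sym d²-dbl-unit)
      (trans (+-cong (square≈0 a≈) (square≈0 b≈)) (+-identityˡ 0#))))
      where
      square≈0 : ∀ {x y} → x ≈ y → (x - y) * (x - y) ≈ 0#
      square≈0 x≈y = trans (*-congʳ (x≈y⇒x∙y⁻¹≈ε x≈y)) (zeroˡ _)

  -- For unit norms the collinearity determinant of the squares is four times the product of the
  -- three pairwise `cross` values, so one of these vanishes.
  dbl-unit-noThree : ∀ {u v w} → norm u ≈ 1# → norm v ≈ 1# → norm w ≈ 1# →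
                     dbl u ⊟ dbl v ∥ dbl u ⊟ dbl w → u ∥ v ⊎ v ∥ w ⊎ u ∥ w
  dbl-unit-noThree {u} {v} {w} norm-u≈1 norm-v≈1 norm-w≈1 par =
    [ [ inj₁ , inj₂ ∘ inj₁ ]′ ∘ xy≈0⇒x≈0⊎y≈0 {cross u v} {cross v w} , inj₂ ∘ inj₂ ]′
      (xy≈0⇒x≈0⊎y≈0 {cross u v * cross v w} {cross u w} (x+x≈0⇒x≈0 {p} (x+x≈0⇒x≈0 {p + p} 4p≈0)))
    where
    p x y z : Carrier
    p = cross u v * cross v w * cross u w
    x = cross (dbl v) (dbl w)
    y = cross (dbl w) (dbl u)
    z = cross (dbl u) (dbl v)
    unit* : ∀ {n} t → n ≈ 1# → n * t ≈ t
    unit* t n≈1 = trans (*-congʳ n≈1) (*-identityˡ t)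
    4p≈0 : (p + p) + (p + p) ≈ 0#
    4p≈0 = begin
      (p + p) + (p + p)                       ≈⟨ norm-cross-dbl u v w ⟨
      norm u * x + norm v * y + norm w * z    ≈⟨ +-cong (+-cong (unit* x norm-u≈1) (unit* y norm-v≈1)) (unit* z norm-w≈1) ⟩
      x + y + z                               ≈⟨ cross-⊟ (dbl u) (dbl v) (dbl w) ⟨
      cross (dbl u ⊟ dbl v) (dbl u ⊟ dbl w)   ≈⟨ par ⟩
      0#                                      ∎

  dbl-unit-arc : ∀ {m} (u : Fin m → Point) → (∀ i → norm (u i) ≈ 1#) →
                 (∀ i j → u i ∥ u j → i ≡ j) → IsArc (dbl ∘ u)
  dbl-unit-arc u norm≈1 ∥⇒≡ =
    (λ i j eq → ∥⇒≡ i j (dbl-unit-injective {u i} {u j} (norm≈1 i) (norm≈1 j) eq)) ,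
    (λ i j → cross (u i) (u j) + cross (u i) (u j) , d²-dbl-unit {u i} {u j} (norm≈1 i) (norm≈1 j)) ,
    λ i j k i≢j i≢k j≢k par → [ i≢j ∘ ∥⇒≡ i j , [ j≢k ∘ ∥⇒≡ j k , i≢k ∘ ∥⇒≡ i k ]′ ]′
      (dbl-unit-noThree {u i} {u j} {u k} (norm≈1 i) (norm≈1 j) (norm≈1 k) par)

  norm-·-dbl : ∀ x v → norm (x · dbl v) ≈ (norm v * x) * (norm v * x)
  norm-·-dbl x (a , b) = solve 3 (λ x a b → let n = normᵖ (a , b) in
    normᵖ (x ·ᵖ dblᵖ (a , b)) := (n :* x) :* (n :* x)) refl x a b

  cross-· : ∀ x y u v → cross (x · u) (y · v) ≈ x * (y * cross u v)
  cross-· x y (a , b) (c , d) = solve 6 (λ x y a b c d →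
    crossᵖ (x ·ᵖ (a , b)) (y ·ᵖ (c , d)) := x :* (y :* crossᵖ (a , b) (c , d))) refl x y a b c d

  ·-∥⁻¹ : ∀ {x y u v} → ¬ x ≈ 0# → ¬ y ≈ 0# → x · u ∥ y · v → u ∥ v
  ·-∥⁻¹ {x} {y} {u} {v} x≉0 y≉0 xu∥yv = cancel {y} y≉0 (cancel {x} x≉0 (trans (sym (cross-· x y u v)) xu∥yv))
    where
    cancel : ∀ {x y} → ¬ x ≈ 0# → x * y ≈ 0# → y ≈ 0#
    cancel {x} {y} x≉0 xy≈0 = [ (λ x≈0 → contradiction x≈0 x≉0) , id ]′ (xy≈0⇒x≈0⊎y≈0 {x} {y} xy≈0)

  -- The point v / v̄ of the unit circle.
  unit : Point → Point
  unit v = norm v ⁻¹ · dbl v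

  norm-unit : ∀ {v} → ¬ norm v ≈ 0# → norm (unit v) ≈ 1#
  norm-unit {v} norm≉0 = trans (norm-·-dbl (norm v ⁻¹) v)
    (trans (*-cong (*-inverseʳ norm≉0) (*-inverseʳ norm≉0)) (*-identityˡ 1#))

  unit-∥⁻¹ : ∀ {u v} → ¬ norm u ≈ 0# → ¬ norm v ≈ 0# → unit u ∥ unit v → u ∥ v ⊎ rot u ∥ v
  unit-∥⁻¹ {u} {v} norm-u≉0 norm-v≉0 par =
    dbl-∥⁻¹ {u} {v} (·-∥⁻¹ {norm u ⁻¹} {norm v ⁻¹} {dbl u} {dbl v} (⁻¹≉0 norm-u≉0) (⁻¹≉0 norm-v≉0) par)
    where
    ⁻¹≉0 : ∀ {x} → ¬ x ≈ 0# → ¬ x ⁻¹ ≈ 0#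
    ⁻¹≉0 x≉0 x⁻¹≈0 = 1≉0 (trans (sym (*-inverseʳ x≉0)) (trans (*-congˡ x⁻¹≈0) (zeroʳ _)))

  A⇒norm≉0 : ∀ {x} → A x → ¬ norm (rep x) ≈ 0#
  A⇒norm≉0 {x} (moved , _) norm≈0 = moved (norm≈0⇒fixed {x} norm≈0)

  -- `unit v` has the direction of `v²`, so parallel values come from one orbit of `τ`, and `A`
  -- meets each orbit at most once.
  unit-rep-injective : ∀ {x y} → A x → A y → unit (rep x) ∥ unit (rep y) → x ≡ y
  unit-rep-injective {x} {y} ax ay par = A-representative {x} {y} ax ay
    (same-class (unit-∥⁻¹ {rep x} {rep y} (A⇒norm≉0 {x} ax) (A⇒norm≉0 {y} ay) par))
    where
    same-class : rep x ∥ rep y ⊎ rot (rep x) ∥ rep y → y ≡ x ⊎ y ≡ τ x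
    same-class (inj₁ eq) = inj₁ (≡.sym (rep-injective {x} {y} eq))
    same-class (inj₂ eq) = inj₂ (≡.sym (rot∥⇒ρρ≡ {x} {y} eq))

  attained-#A : Attained (count A?)
  attained-#A = arc⇒attained (dbl-unit-arc (λ k → unit (rep (nth A? k)))
    (λ k → norm-unit {rep (nth A? k)} (A⇒norm≉0 {nth A? k} (nth-satisfies A? k)))
    (λ k l par → nth-injective A? {k} {l}
      (unit-rep-injective {nth A? k} {nth A? l} (nth-satisfies A? k) (nth-satisfies A? l) par)))

  -- Upper bound: directions as colours.

  module _ {m} {f : Fin m → Point} (arc : IsArc f) where

    private
      f-injective = proj₁ arc
      f-integral  = proj₁ (proj₂ arc)
      f-noThree   = proj₂ (proj₂ arc)

      slope : Fin m → Fin m → Fin (suc q)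
      slope i j = proj (f i ⊟ f j)

      ⊟-∥-swap : ∀ u v → u ⊟ v ∥ v ⊟ u
      ⊟-∥-swap (a , b) (c , d) = trans
        (solve 4 (λ a b c d → crossᵖ ((a , b) ⊟ᵖ (c , d)) ((c , d) ⊟ᵖ (a , b)) := a :- a) refl a b c d) (-‿inverseʳ a)

      f-nonZero : ∀ {i j} → i ≢ j → NonZero (f i ⊟ f j)
      f-nonZero i≢j = ⊟-nonZero (i≢j ∘ f-injective _ _)

      slope-sym : ∀ i j → slope i j ≡ slope j i
      slope-sym i j with i Fin.≟ j
      ... | yes ≡.refl = ≡.refl
      ... | no i≢j     = ∥⇒proj≡ (f-nonZero i≢j) (f-nonZero (i≢j ∘ ≡.sym)) (⊟-∥-swap (f i) (f j))

      -- Equal slopes at `i` would put the points of `i`, `j` and `k` on one line.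
      slope-proper : ∀ {i j k} → i ≢ j → i ≢ k → slope i j ≡ slope i k → j ≡ k
      slope-proper {i} {j} {k} i≢j i≢k eq with j Fin.≟ k
      ... | yes j≡k = j≡k
      ... | no  j≢k = contradiction (proj≡⇒∥ {f i ⊟ f j} {f i ⊟ f k} eq) (f-noThree i j k i≢j i≢k j≢k)

    -- Any colour in the image may serve as `c₀`; `sq zero` is one.
    open ProperColouring Image? {sq zero} (zero , ≡.refl) slope slope-sym
      (λ i≢j → integral⇒∈Image (f-nonZero i≢j) (f-integral _ _)) slope-proper

    arc⇒size≤ : m ≤ count Fixed? ℕ.+ count A?
    arc⇒size≤ = m≤even-bound #image≤ (2∣#fixed+#A (2∤n⇒2∣1+n 2∤q))

  attained⇒≤ : ∀ m → Attained m → m ≤ count Fixed? ℕ.+ count A?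
  attained⇒≤ m = arc⇒size≤ ∘ proj₂ ∘ attained⇒arc

  -- Isotropic directions and square roots of `-1`.

  -- At infinity the norm is `1`, and `(x : 1)` is isotropic only if `x² = -1`.
  norm-rep≈0⇒-1-square : ∀ x → norm (rep x) ≈ 0# → IsSquare -1#
  norm-rep≈0⇒-1-square zero norm≈0 = contradiction (begin
    1#                 ≈⟨ *-identityˡ 1# ⟨
    1# * 1#            ≈⟨ +-identityʳ _ ⟨
    1# * 1# + 0#       ≈⟨ +-congˡ (zeroˡ 0#) ⟨
    1# * 1# + 0# * 0#  ≈⟨ norm≈0 ⟩
    0#                 ∎) 1≉0
  norm-rep≈0⇒-1-square (suc i) norm≈0 = from i , (begin
    - 1#                                   ≈⟨ -‿cong (*-identityˡ 1#) ⟨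
    - (1# * 1#)                            ≈⟨ +-identityˡ _ ⟨
    0# - 1# * 1#                           ≈⟨ +-congʳ norm≈0 ⟨
    from i * from i + 1# * 1# - 1# * 1#    ≈⟨ solve 2 (λ x y → x :+ y :- y := x) refl _ _ ⟩
    from i * from i                        ∎)

  #fixed≡0 : ¬ IsSquare -1# → count Fixed? ≡ 0
  #fixed≡0 ¬square = empty⇒count≡0 Fixed? (λ x fixed → ¬square (norm-rep≈0⇒-1-square x (fixed⇒norm≈0 {x} fixed)))

  module _ {ι : Carrier} (-1≈ιι : -1# ≈ ι * ι) where

    private
      root : Fin 2 → Carrier
      root zero       = ι
      root (suc zero) = - ι

      same-ratio⇒∥ : ∀ {t a b c d} → a ≈ t * b → c ≈ t * d → (a , b) ∥ (c , d)
      same-ratio⇒∥ {t} {a} {b} {c} {d} a≈tb c≈td = begin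
        a * d - b * c              ≈⟨ +-cong (*-congʳ a≈tb) (-‿cong (*-congˡ c≈td)) ⟩
        t * b * d - b * (t * d)    ≈⟨ solve 3 (λ t b d → t :* b :* d :- b :* (t :* d) := t :- t) refl t b d ⟩
        t - t                      ≈⟨ -‿inverseʳ t ⟩
        0#                         ∎

      isotropic-product : ∀ a b → norm (a , b) ≈ 0# → (a - ι * b) * (a - - ι * b) ≈ 0#
      isotropic-product a b norm≈0 = begin
        (a - ι * b) * (a - - ι * b)
          ≈⟨ solve 3 (λ a b i → (a :- i :* b) :* (a :- :- i :* b) := a :* a :- i :* i :* (b :* b)) refl a b ι ⟩
        a * a - ι * ι * (b * b)      ≈⟨ +-congˡ (-‿cong (*-congʳ -1≈ιι)) ⟨
        a * a - - 1# * (b * b)       ≈⟨ solve 2 (λ a b → a :* a :- :- con (ℤ.+ 1) :* (b :* b) := normᵖ (a , b)) refl a b ⟩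
        norm (a , b)                 ≈⟨ norm≈0 ⟩
        0#                           ∎

      Ratio : Fin (suc q) → Fin 2 → Set ℓ₁
      Ratio x s = proj₁ (rep x) ≈ root s * proj₂ (rep x)

      -- Given `ι² = -1`, the norm splits into the linear forms `a - ι b` and `a + ι b`. One of them
      -- vanishes on an isotropic vector, and which one it is determines the direction.
      ratio : ∀ x → τ x ≡ x → ∃[ s ] Ratio x s
      ratio x fixed =
        [ (λ eq → zero , x∙y⁻¹≈ε⇒x≈y a (ι * b) eq) , (λ eq → suc zero , x∙y⁻¹≈ε⇒x≈y a (- ι * b) eq) ]′
        (xy≈0⇒x≈0⊎y≈0 {a - ι * b} {a - - ι * b} (isotropic-product a b (fixed⇒norm≈0 {x} fixed)))
        where
        a = proj₁ (rep x)
        b = proj₂ (rep x)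

      ratio-injective : ∀ {x y s t} → Ratio x s → Ratio y t → s ≡ t → x ≡ y
      ratio-injective {x} {y} {s} x-ratio y-ratio ≡.refl = rep-injective {x} {y}
        (same-ratio⇒∥ {root s} {proj₁ (rep x)} {proj₂ (rep x)} {proj₁ (rep y)} {proj₂ (rep y)} x-ratio y-ratio)

    #fixed≤2 : count Fixed? ≤ 2
    #fixed≤2 = injection⇒count-≤ Fixed? (λ x fixed → proj₁ (ratio x fixed))
      (λ {x} {y} fx fy →
        ratio-injective {x} {y} {proj₁ (ratio x fx)} {proj₁ (ratio y fy)} (proj₂ (ratio x fx)) (proj₂ (ratio y fy)))

  -- The bounds and the existence of the maximum.

  Bounds : ℕ → Set (c ⊔ ℓ₁)
  Bounds Ī = (¬ IsSquare -1# → Ī ≡ (q ℕ.+ 1) / 2) × (IsSquare -1# → (q ℕ.∸ 1) / 2 ≤ Ī × Ī ≤ (q ℕ.+ 3) / 2)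

  -- `Ī` lies between the size of `A` and that size plus the number of fixed points, which is zero
  -- in the first case and at most two in the second.
  IsĪ⇒bounds : ∀ {Ī} → IsĪ Ī → Bounds Ī
  IsĪ⇒bounds {Ī} (attained-Ī , maximal) =
    (λ ¬square → ≡.trans
      (ℕ.≤-antisym (≡.subst (λ f → Ī ≤ f ℕ.+ count A?) (#fixed≡0 ¬square) Ī≤#fixed+#A) #A≤Ī)
      (f≡0⇒a≡[q+1]/2 {q} {count Fixed?} {count A?} n≡#fixed+#A*2 (#fixed≡0 ¬square))) ,
    (λ (_ , -1≈ιι) →
      ℕ.≤-trans (f≤2⇒[q∸1]/2≤a {q} {count Fixed?} {count A?} n≡#fixed+#A*2 (#fixed≤2 -1≈ιι)) #A≤Ī ,
      ℕ.≤-trans Ī≤#fixed+#A (f≤2⇒f+a≤[q+3]/2 {q} {count Fixed?} {count A?} n≡#fixed+#A*2 (#fixed≤2 -1≈ιι)))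
    where
    #A≤Ī : count A? ≤ Ī
    #A≤Ī = maximal (count A?) attained-#A
    Ī≤#fixed+#A : Ī ≤ count Fixed? ℕ.+ count A?
    Ī≤#fixed+#A = attained⇒≤ Ī attained-Ī

  -- Found by search, as attainability is decidable, bounded, and holds for the size of `A`.
  maximum : ∃[ Ī ] IsĪ Ī
  maximum = bounded⇒maximum attained? {count A?} (count Fixed? ℕ.+ count A?) attained-#A attained⇒≤

open import Data.Nat.Base using (_+_; _∸_)

corollary4 : ∀ {c ℓ₁ ℓ₂ : Level} (q : ℕ) → OddPrimePower q →
    (F : HeytingField c ℓ₁ ℓ₂) →
    HasCardinality (HeytingField.setoid F) q →
    ∃[ Ī ] (Plane.IsĪ F Ī
    × (¬ (Plane.IsSquare F (Plane.-1# F)) → Ī ≡ (q + 1) / 2)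
    × (Plane.IsSquare F (Plane.-1# F) → (q ∸ 1) / 2 ≤ Ī × Ī ≤ (q + 3) / 2))
corollary4 q (2∤q , _) F card = proj₁ maximum , proj₂ maximum , IsĪ⇒bounds (proj₂ maximum)
  where open OddField 2∤q F card
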